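{- Let $k>s$ be positive integers, for $n\ge1$ let $b_n^{(k,s)}$ be the number of vertices of the polytope $P_{n,k,s}$, and let $\lambda_1$ be the largest positive eigenvalue of the matrix $A_{k,s}$. Then $$\lim_{n\to\infty}\frac1n\ln b_n^{(k,s)}=\ln\lambda_1.$$
   Context: For positive integers $n,k,s$ let $K=s(n-1)+k$ and let $e_0,\ldots,e_{K-1}$ be the standard basis of $\mathbb{R}^{K}$. For $0\le i\le n-1$ put $\{si,si+1,\ldots,si+k-1\}=:W_i$ and $\Delta_{W_i}=\operatorname{conv}\{e_j: j\in W_i\}$. Then $P_{n,k,s}=\sum_{i=0}^{n-1}\Delta_{W_i}$ (Minkowski sum). For $k>s$, $D_{k,s}$ is the digraph with vertex set $\{0,\ldots,k-1\}$ containing all possible arcs (including loops) except the arcs $(s+i',j')$ with $i',j'\in\{0,\ldots,k-1-s\}$ and $i'\neq j'$. Its adjacency matrix $A_{k,s}=(a_{ij})_{i,j=1}^k$ has $a_{ij}=1$ if $(i-1,j-1)$ is an arc and $a_{ij}=0$ otherwise. -}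

module Defs where

open import Algebra.Bundles using (CommutativeRing)
import Algebra.Properties.CommutativeMonoid.Sum as Sum
import Algebra.Properties.Monoid.Mult as Mult
import Algebra.Properties.Semiring.Exp as Exp
open import Data.Bool using (if_then_else_)
open import Data.Fin using (Fin; toℕ)
import Data.Fin.Properties as Fin
open import Data.Nat as ℕ using (ℕ; _∸_; _!)
import Data.Nat.Properties as ℕ
open import Data.Product using (_×_; ∃; ∃₂; ∃-syntax; proj₁)
open import Data.Vec.Functional using (Vector)
import Data.Vec.Functional.Relation.Binary.Equality.Setoid as VectorEquality
open import Function using (_⇔_; Bijection)
open import Level using (0ℓ) renaming (suc to lsuc)
open import Relation.Binary using (Rel; Setoid; IsStrictTotalOrder; Decidable)
import Relation.Binary.Construct.On as On
import Relation.Binary.Construct.StrictToNonStrict as StrictToNonStrict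
open import Relation.Binary.PropositionalEquality as ≡ using (_≡_; _≢_)
open import Relation.Nullary using (¬_; does; ¬?; _×-dec_)
open import Relation.Unary using (Pred; _∈_)

-- The real numbers, given axiomatically as a Dedekind-complete ordered field;
-- these axioms determine the structure up to unique isomorphism.  Equality is
-- a setoid equality, and 0# ⁻¹ is an unspecified value.
--
-- The second clause in the conclusion of `sup` is the usual positive form of
-- "s is the least upper bound".  Together with the trichotomy of _<_ it makes
-- excluded middle for Set derivable from any such structure, so these are the
-- reals of classical mathematics and no separate classical axiom is needed.
record RealNumbers : Set (lsuc 0ℓ) where
  field
    commutativeRing : CommutativeRing 0ℓ 0ℓ

  open CommutativeRing commutativeRing public

  infix 4 _<_
  infix 8 _⁻¹

  field
    _⁻¹                : Carrier → Carrier
    1≉0                : ¬ (1# ≈ 0#)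
    *-inverse          : ∀ x → ¬ (x ≈ 0#) → x * x ⁻¹ ≈ 1#
    _<_                : Rel Carrier 0ℓ
    isStrictTotalOrder : IsStrictTotalOrder _≈_ _<_
    +-mono-<           : ∀ x y z → x < y → x + z < y + z
    *-pos              : ∀ x y → 0# < x → 0# < y → 0# < x * y

  open StrictToNonStrict _≈_ _<_ public using (_≤_)

  field
    sup : (S : Pred Carrier 0ℓ) → ∃ S →
          (∃[ u ] (∀ x → x ∈ S → x ≤ u)) →
          ∃[ s ] (∀ x → x ∈ S → x ≤ s)
               × (∀ y → y < s → ∃[ x ] (x ∈ S × y < x))

-- The pairs (s + i′ , j′) with i′ ≠ j′ in {0, …, k - 1 - s}.
MissingArc : (k s : ℕ) → Rel (Fin k) 0ℓ
MissingArc k s u v = ∃₂ λ (i′ j′ : Fin (k ∸ s)) →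
  toℕ u ≡ s ℕ.+ toℕ i′ × toℕ v ≡ toℕ j′ × i′ ≢ j′

-- The digraph D_{k,s} on the vertex set {0, …, k - 1}.
Arc : (k s : ℕ) → Rel (Fin k) 0ℓ
Arc k s u v = ¬ MissingArc k s u v

arc? : (k s : ℕ) → Decidable (Arc k s)
arc? k s u v = ¬? (Fin.any? λ i′ → Fin.any? λ j′ →
  (toℕ u ℕ.≟ s ℕ.+ toℕ i′) ×-dec ((toℕ v ℕ.≟ toℕ j′) ×-dec ¬? (i′ Fin.≟ j′)))

-- The dimension K of the ambient space of P_{n,k,s}, for n ≥ 1.
ambientDim : (n k s : ℕ) → ℕ
ambientDim n k s = s ℕ.* (n ∸ 1) ℕ.+ k

Window : (n k s : ℕ) → Fin n → Pred (Fin (ambientDim n k s)) 0ℓ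
Window n k s i j =
  s ℕ.* toℕ i ℕ.≤ toℕ j × toℕ j ℕ.< s ℕ.* toℕ i ℕ.+ k

module Over (R : RealNumbers) where
  open RealNumbers R public
  open Sum +-commutativeMonoid public using (sum)
  open Mult +-monoid public using () renaming (_×_ to _·_)
  open Exp semiring public using (_^_)

  fromℕ : ℕ → Carrier
  fromℕ n = n · 1#

  infix 4 _⟶_
  _⟶_ : (ℕ → Carrier) → Carrier → Set
  a ⟶ l = ∀ ε → 0# < ε →
    ∃[ N ] (∀ n → N ℕ.≤ n → a n - l < ε × l - a n < ε)

  -- exp y ≈ x, with exp given by its power series.
  IsExp : Carrier → Carrier → Set
  IsExp y x =
    (λ N → sum {N} λ m → y ^ toℕ m * fromℕ (toℕ m !) ⁻¹) ⟶ x

  -- ln is the inverse of exp on the positive reals; its values elsewhere are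
  -- unconstrained.
  IsNaturalLog : (Carrier → Carrier) → Set
  IsNaturalLog ln = ∀ x → 0# < x → IsExp (ln x) x

  Point : ℕ → Set
  Point d = Vector Carrier d

  open VectorEquality setoid public
    using (_≋_; ≋-setoid)

  basis : ∀ {d} → Fin d → Point d
  basis j i = if does (i Fin.≟ j) then 1# else 0#

  conv : ∀ {d} → Pred (Point d) 0ℓ → Pred (Point d) 0ℓ
  conv {d} S x = ∃[ m ] ∃₂ λ (p : Fin m → Point d) (w : Fin m → Carrier) →
      (∀ i → p i ∈ S)
    × (∀ i → 0# ≤ w i)
    × sum w ≈ 1#
    × x ≋ (λ j → sum λ i → w i * p i j)

  minkowskiSum : ∀ {d n} → (Fin n → Pred (Point d) 0ℓ) → Pred (Point d) 0ℓ
  minkowskiSum {d} {n} A x = ∃ λ (y : Fin n → Point d) →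
    (∀ i → y i ∈ A i) × x ≋ (λ j → sum λ i → y i j)

  simplex : ∀ {d} → Pred (Fin d) 0ℓ → Pred (Point d) 0ℓ
  simplex W = conv λ x → ∃[ j ] (j ∈ W × x ≋ basis j)

  polytope : (n k s : ℕ) → Pred (Point (ambientDim n k s)) 0ℓ
  polytope n k s = minkowskiSum λ i → simplex (Window n k s i)

  infix 7 _∙_
  _∙_ : ∀ {d} → Point d → Point d → Carrier
  c ∙ x = sum λ j → c j * x j

  -- v is a vertex of P: {v} is a face of P, i.e. the set of points of P at
  -- which some inequality c ∙ x ≤ c₀ valid on P holds with equality.
  IsVertex : ∀ {d} → Pred (Point d) 0ℓ → Pred (Point d) 0ℓ
  IsVertex P v = ∃₂ λ c c₀ →
      (∀ x → x ∈ P → c ∙ x ≤ c₀)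
    × (∀ x → (x ∈ P × c ∙ x ≈ c₀) ⇔ x ≋ v)

  vertexSetoid : ∀ {d} → Pred (Point d) 0ℓ → Setoid 0ℓ 0ℓ
  vertexSetoid {d} P = On.setoid {B = ∃ (IsVertex P)} (≋-setoid d) proj₁

  HasVertexCount : ∀ {d} → Pred (Point d) 0ℓ → ℕ → Set
  HasVertexCount P m = Bijection (≡.setoid (Fin m)) (vertexSetoid P)

  Matrix : ℕ → Set
  Matrix d = Fin d → Fin d → Carrier

  adjacencyMatrix : (k s : ℕ) → Matrix k
  adjacencyMatrix k s i j = if does (arc? k s i j) then 1# else 0#

  IsEigenvalue : ∀ {d} → Matrix d → Pred Carrier 0ℓ
  IsEigenvalue {d} A μ = ∃ λ (v : Point d) →
      ¬ (v ≋ λ _ → 0#)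
    × (λ i → sum λ j → A i j * v j) ≋ (λ i → μ * v i)

  IsLargestPositiveEigenvalue : ∀ {d} → Matrix d → Pred Carrier 0ℓ
  IsLargestPositiveEigenvalue A μ =
      0# < μ
    × IsEigenvalue A μ
    × (∀ ν → 0# < ν → IsEigenvalue A ν → ν ≤ μ)

-- A vertex of P_{n,k,s} is the sum of the points e_{p(i)}, p(i) ∈ W_i, at which a linear
-- functional attains its maxima on the windows.  In the relative coordinates u(i) = p(i) - si
-- the choices that occur are exactly the walks on n vertices of D_{k,s}: if both p(i) and
-- p(i+1) lie in W_i ∩ W_{i+1}, they coincide; conversely a functional peaking at the p(i) is
-- built window by window.  Since 0 has arcs to all vertices, b_n counts the walks of n arcs
-- starting at 0.  An eigenvector for λ₁ bounds this number below by a multiple of λ₁ⁿ, and a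
-- positive eigenvector, whose eigenvalue ν satisfies ν ≤ λ₁, bounds it above by a multiple
-- of νⁿ.  The shift structure of the arcs reduces the existence of the latter to a first zero
-- of a polynomial in 1/ν.  Logarithms turn the two bounds into the limit.
module Submission where

import Algebra.Properties.AbelianGroup as AbelianGroupProperties
import Algebra.Properties.CommutativeSemiring.Binomial as Binomial
import Algebra.Properties.Ring as RingProperties
import Algebra.Properties.Semiring.Exp as Exp
import Algebra.Properties.Semiring.Mult as Mult
import Algebra.Properties.Semiring.Mult.TCOptimised as Mult′
import Algebra.Properties.Semiring.Sum as Sum
import Algebra.Solver.Ring as RingSolver
open import Algebra.Solver.Ring.AlmostCommutativeRing
  using (AlmostCommutativeRing; fromCommutativeRing; _-Raw-AlmostCommutative⟶_)
open import Data.Bool using (true; false; if_then_else_)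
open import Data.Empty using (⊥-elim)
open import Data.Fin as Fin using (Fin; zero; suc; toℕ; fromℕ<; _↑ˡ_; _↑ʳ_; splitAt)
import Data.Fin.Properties as Fin
open import Data.Integer as ℤ using (ℤ; +_; -[1+_]; +[1+_])
import Data.Integer.Properties as ℤ
open import Data.Maybe using (Maybe; just; nothing)
open import Data.Nat as ℕ using (ℕ; zero; suc; _∸_; _!)
open import Data.Nat.Combinatorics using (_C_; nCk≡n!/k![n-k]!; k![n∸k]!∣n!)
open import Data.Nat.DivMod using (m/n*n≡m; m<n⇒m/n≡0; m/n≡1+[m∸n]/n)
import Data.Nat.Properties as ℕ
open import Data.Product using (_×_; _,_; proj₁; proj₂; ∃; ∃-syntax)
import Data.Sign as Sign
open import Data.Sum using (_⊎_; inj₁; inj₂)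
import Data.Vec.Functional as Vector
open import Function using (_∘_; mk⇔; Bijection; Equivalence)
open import Level using (0ℓ)
open import Relation.Binary using (IsStrictTotalOrder; tri<; tri≈; tri>)
import Relation.Binary.Construct.StrictToNonStrict as StrictToNonStrict
open import Relation.Binary.PropositionalEquality as ≡ using (_≡_; _≢_)
open import Relation.Nullary using (Dec; ¬_; yes; no; does)
open import Relation.Nullary.Decidable using (dec-true; dec-false)
open import Relation.Unary using (Pred; _∈_)
open import Defs

-- Perron's theorem in general rests on compactness or a fixed point argument; the arcs allow a
-- direct construction. An eigenvector for `1/t` is fixed by two numbers, its total mass and its
-- mass on the vertices from `k - s` on, so its existence means that a 2 by 2 system is singular.
-- The determinant is `h₃`. A zero of `h₃` alone could yield a vector of mixed signs, hence the
-- diagonal entries `h₁` and `h₂` are kept nonnegative together with it. The eigenvalue found is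
-- never identified with `λ₁`: an inequality is enough, since the lower bound already works with
-- `λ₁` and an eigenvector of arbitrary signs. Maxima in windows are chosen leftmost, so that every
-- functional yields a walk and uniqueness of its maxima need not be shown. As `ln` is given only
-- through the power series of its values, the addition theorem and the reflection of order come
-- from estimates on partial sums.

-- Solving ring identities over the reals with integer coefficients.

module IntegerCoefficients (R : RealNumbers) where
  open Over R hiding (zero)
  open RingProperties ring using (-‿distribˡ-*; -‿distribʳ-*; -0#≈0#; -‿involutive)
  open AbelianGroupProperties +-abelianGroup using (⁻¹-∙-comm)
  open Mult′ semiring using (1+×; ×-homo-+; ×1-homo-*) renaming (_×_ to _⊗_)
  open import Relation.Binary.Reasoning.Setoid setoid

  -- The multiple `_⊗_` takes 1 to `1#` and 2 to `1# + 1#` by computation, so `con (+ 1)` and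
  -- `con (+ 2)` in solver goals agree definitionally with the numerals of the surrounding terms.
  ⟦_⟧ℤ : ℤ → Carrier
  ⟦ + n ⟧ℤ      = n ⊗ 1#
  ⟦ -[1+ n ] ⟧ℤ = - (suc n ⊗ 1#)

  ⟦-⟧ : ∀ i → ⟦ ℤ.- i ⟧ℤ ≈ - ⟦ i ⟧ℤ
  ⟦-⟧ (+ zero)   = sym -0#≈0#
  ⟦-⟧ +[1+ n ]   = refl
  ⟦-⟧ (-[1+ n ]) = sym (-‿involutive _)

  cancel-middle : ∀ a b c → (a + b) - (a + c) ≈ b - c
  cancel-middle a b c = begin
    (a + b) - (a + c)       ≈⟨ +-congˡ (⁻¹-∙-comm a c) ⟨
    (a + b) + (- a + - c)   ≈⟨ +-assoc _ _ _ ⟩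
    a + (b + (- a + - c))   ≈⟨ +-congˡ (+-assoc _ _ _) ⟨
    a + ((b + - a) + - c)   ≈⟨ +-congˡ (+-congʳ (+-comm _ _)) ⟩
    a + ((- a + b) + - c)   ≈⟨ +-congˡ (+-assoc _ _ _) ⟩
    a + (- a + (b - c))     ≈⟨ +-assoc _ _ _ ⟨
    (a + - a) + (b - c)     ≈⟨ +-congʳ (-‿inverseʳ a) ⟩
    0# + (b - c)            ≈⟨ +-identityˡ _ ⟩
    b - c                   ∎

  ⟦⊖⟧ : ∀ m n → ⟦ m ℤ.⊖ n ⟧ℤ ≈ m ⊗ 1# - n ⊗ 1#
  ⟦⊖⟧ m zero = begin
    m ⊗ 1#        ≈⟨ +-identityʳ _ ⟨
    m ⊗ 1# + 0#   ≈⟨ +-congˡ -0#≈0# ⟨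
    m ⊗ 1# - 0#   ∎
  ⟦⊖⟧ zero (suc n) = sym (+-identityˡ _)
  ⟦⊖⟧ (suc m) (suc n) = begin
    ⟦ suc m ℤ.⊖ suc n ⟧ℤ            ≡⟨ ≡.cong ⟦_⟧ℤ (ℤ.[1+m]⊖[1+n]≡m⊖n m n) ⟩
    ⟦ m ℤ.⊖ n ⟧ℤ                    ≈⟨ ⟦⊖⟧ m n ⟩
    m ⊗ 1# - n ⊗ 1#                 ≈⟨ cancel-middle 1# _ _ ⟨
    (1# + m ⊗ 1#) - (1# + n ⊗ 1#)   ≈⟨ +-cong (1+× m 1#) (-‿cong (1+× n 1#)) ⟨
    suc m ⊗ 1# - suc n ⊗ 1#         ∎

  ⟦+⟧ : ∀ i j → ⟦ i ℤ.+ j ⟧ℤ ≈ ⟦ i ⟧ℤ + ⟦ j ⟧ℤ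
  ⟦+⟧ (+ m) (+ n) = ×-homo-+ 1# m n
  ⟦+⟧ (+ m) (-[1+ n ]) = ⟦⊖⟧ m (suc n)
  ⟦+⟧ (-[1+ m ]) (+ n) = trans (⟦⊖⟧ n (suc m)) (+-comm _ _)
  ⟦+⟧ (-[1+ m ]) (-[1+ n ]) = begin
    - (suc (suc (m ℕ.+ n)) ⊗ 1#)        ≡⟨ ≡.cong (λ l → - (suc l ⊗ 1#)) (ℕ.+-suc m n) ⟨
    - ((suc m ℕ.+ suc n) ⊗ 1#)          ≈⟨ -‿cong (×-homo-+ 1# (suc m) (suc n)) ⟩
    - (suc m ⊗ 1# + suc n ⊗ 1#)         ≈⟨ ⁻¹-∙-comm _ _ ⟨
    - (suc m ⊗ 1#) + - (suc n ⊗ 1#)     ∎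

  ⟦*⟧ : ∀ i j → ⟦ i ℤ.* j ⟧ℤ ≈ ⟦ i ⟧ℤ * ⟦ j ⟧ℤ
  ⟦*⟧ (+ m) (+ n) = begin
    ⟦ Sign.+ ℤ.◃ m ℕ.* n ⟧ℤ   ≡⟨ ≡.cong ⟦_⟧ℤ (ℤ.+◃n≡+n (m ℕ.* n)) ⟩
    (m ℕ.* n) ⊗ 1#            ≈⟨ ×1-homo-* m n ⟩
    m ⊗ 1# * n ⊗ 1#           ∎
  ⟦*⟧ (+ m) (-[1+ n ]) = begin
    ⟦ Sign.- ℤ.◃ m ℕ.* suc n ⟧ℤ       ≡⟨ ≡.cong ⟦_⟧ℤ (ℤ.-◃n≡-n (m ℕ.* suc n)) ⟩
    ⟦ ℤ.- (+ (m ℕ.* suc n)) ⟧ℤ        ≈⟨ ⟦-⟧ (+ (m ℕ.* suc n)) ⟩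
    - ((m ℕ.* suc n) ⊗ 1#)            ≈⟨ -‿cong (×1-homo-* m (suc n)) ⟩
    - (m ⊗ 1# * suc n ⊗ 1#)           ≈⟨ -‿distribʳ-* _ _ ⟩
    m ⊗ 1# * - (suc n ⊗ 1#)           ∎
  ⟦*⟧ (-[1+ m ]) (+ n) = begin
    ⟦ Sign.- ℤ.◃ suc m ℕ.* n ⟧ℤ       ≡⟨ ≡.cong ⟦_⟧ℤ (ℤ.-◃n≡-n (suc m ℕ.* n)) ⟩
    ⟦ ℤ.- (+ (suc m ℕ.* n)) ⟧ℤ        ≈⟨ ⟦-⟧ (+ (suc m ℕ.* n)) ⟩
    - ((suc m ℕ.* n) ⊗ 1#)            ≈⟨ -‿cong (×1-homo-* (suc m) n) ⟩
    - (suc m ⊗ 1# * n ⊗ 1#)           ≈⟨ -‿distribˡ-* _ _ ⟩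
    - (suc m ⊗ 1#) * n ⊗ 1#           ∎
  ⟦*⟧ (-[1+ m ]) (-[1+ n ]) = begin
    (suc m ℕ.* suc n) ⊗ 1#                ≈⟨ ×1-homo-* (suc m) (suc n) ⟩
    suc m ⊗ 1# * suc n ⊗ 1#               ≈⟨ -‿involutive _ ⟨
    - - (suc m ⊗ 1# * suc n ⊗ 1#)         ≈⟨ -‿cong (-‿distribʳ-* _ _) ⟩
    - (suc m ⊗ 1# * - (suc n ⊗ 1#))       ≈⟨ -‿distribˡ-* _ _ ⟩
    - (suc m ⊗ 1#) * - (suc n ⊗ 1#)       ∎

  almostCommutativeRing : AlmostCommutativeRing _ _
  almostCommutativeRing = fromCommutativeRing commutativeRing

  morphism : ℤ.+-*-rawRing -Raw-AlmostCommutative⟶ almostCommutativeRing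
  morphism = record
    { ⟦_⟧ = ⟦_⟧ℤ ; +-homo = ⟦+⟧ ; *-homo = ⟦*⟧ ; -‿homo = ⟦-⟧ ; 0-homo = refl ; 1-homo = refl }

  ⟦_⟧≟⟦_⟧ : ∀ i j → Maybe (⟦ i ⟧ℤ ≈ ⟦ j ⟧ℤ)
  ⟦ i ⟧≟⟦ j ⟧ with i ℤ.≟ j
  ... | yes i≡j = just (reflexive (≡.cong ⟦_⟧ℤ i≡j))
  ... | no _    = nothing

  open RingSolver ℤ.+-*-rawRing almostCommutativeRing morphism ⟦_⟧≟⟦_⟧ public
    using (solve; con; _:+_; _:*_; _:-_; :-_; _:=_)

-- Ordered field arithmetic and bounds on absolute values.

module OrderedField (R : RealNumbers) where
  open Over R public hiding (zero)
  open IntegerCoefficients R public using (solve; con; _:+_; _:*_; _:-_; :-_; _:=_)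

  private module STO = IsStrictTotalOrder isStrictTotalOrder

  open STO public using (compare; <-resp-≈; <-respʳ-≈; <-respˡ-≈; irrefl; _≟_) renaming (trans to <-trans)

  ≤-refl : ∀ {x} → x ≤ x
  ≤-refl = inj₂ refl

  ≤-reflexive : ∀ {x y} → x ≈ y → x ≤ y
  ≤-reflexive = inj₂

  <⇒≤ : ∀ {x y} → x < y → x ≤ y
  <⇒≤ = inj₁

  ≤-trans : ∀ {x y z} → x ≤ y → y ≤ z → x ≤ z
  ≤-trans = StrictToNonStrict.trans _≈_ _<_ isEquivalence <-resp-≈ <-trans

  <-≤-trans : ∀ {x y z} → x < y → y ≤ z → x < z
  <-≤-trans = StrictToNonStrict.<-≤-trans _≈_ _<_ <-trans <-respʳ-≈

  ≤-<-trans : ∀ {x y z} → x ≤ y → y < z → x < z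
  ≤-<-trans = StrictToNonStrict.≤-<-trans _≈_ _<_ sym <-trans <-respˡ-≈

  ≤-antisym : ∀ {x y} → x ≤ y → y ≤ x → x ≈ y
  ≤-antisym = StrictToNonStrict.antisym _≈_ _<_ isEquivalence <-trans irrefl

  ≤-respʳ : ∀ {x y z} → y ≈ z → x ≤ y → x ≤ z
  ≤-respʳ eq p = ≤-trans p (≤-reflexive eq)

  ≤-respˡ : ∀ {x y z} → x ≈ y → x ≤ z → y ≤ z
  ≤-respˡ eq p = ≤-trans (≤-reflexive (sym eq)) p

  ≤⇒≯ : ∀ {x y} → x ≤ y → ¬ y < x
  ≤⇒≯ x≤y y<x = irrefl refl (≤-<-trans x≤y y<x)

  <⊎≥ : ∀ x y → x < y ⊎ y ≤ x
  <⊎≥ x y with compare x y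
  ... | tri< x<y _ _ = inj₁ x<y
  ... | tri≈ _ x≈y _ = inj₂ (inj₂ (sym x≈y))
  ... | tri> _ _ y<x = inj₂ (inj₁ y<x)

  ≮⇒≥ : ∀ {x y} → ¬ x < y → y ≤ x
  ≮⇒≥ {x} {y} x≮y with <⊎≥ x y
  ... | inj₁ x<y = ⊥-elim (x≮y x<y)
  ... | inj₂ y≤x = y≤x

  <-difference : ∀ {x y} → x < y → 0# < y - x
  <-difference {x} {y} x<y = <-respˡ-≈ (-‿inverseʳ x) (+-mono-< x y (- x) x<y)

  ≤-difference : ∀ {x y} → x ≤ y → 0# ≤ y - x
  ≤-difference (inj₁ x<y) = inj₁ (<-difference x<y)
  ≤-difference {x} {y} (inj₂ x≈y) = inj₂ (sym (trans (+-congˡ (-‿cong x≈y)) (-‿inverseʳ y)))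

  -- An inequality is certified by its gap: a positive `d` and a ring identity left to the solver.
  -- Most estimates below take this form or that of `≤-intro`.
  <-intro : ∀ {x y d} → 0# < d → x + d ≈ y → x < y
  <-intro {x} {y} {d} 0<d eq = <-respʳ-≈ (trans (+-comm d x) eq) (<-respˡ-≈ (+-identityˡ x) (+-mono-< 0# d x 0<d))

  ≤-intro : ∀ {x y d} → 0# ≤ d → x + d ≈ y → x ≤ y
  ≤-intro (inj₁ 0<d) eq = inj₁ (<-intro 0<d eq)
  ≤-intro {x} (inj₂ 0≈d) eq = inj₂ (trans (sym (+-identityʳ x)) (trans (+-congˡ 0≈d) eq))

  +-mono-<-≤ : ∀ {x y z w} → x < y → z ≤ w → x + z < y + w
  +-mono-<-≤ {x} {y} {z} {w} x<y z≤w = <-≤-trans (+-mono-< x y z x<y) (≤-intro (≤-difference z≤w)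
    (solve 3 (λ y z w → (y :+ z) :+ (w :- z) := y :+ w) refl y z w))

  +-mono-≤-< : ∀ {x y z w} → x ≤ y → z < w → x + z < y + w
  +-mono-≤-< x≤y z<w = <-respˡ-≈ (+-comm _ _) (<-respʳ-≈ (+-comm _ _) (+-mono-<-≤ z<w x≤y))

  +-mono-≤ : ∀ {x y z w} → x ≤ y → z ≤ w → x + z ≤ y + w
  +-mono-≤ (inj₁ x<y) z≤w = inj₁ (+-mono-<-≤ x<y z≤w)
  +-mono-≤ {x} {y} {z} {w} (inj₂ x≈y) z≤w = ≤-intro (≤-difference z≤w) (trans (+-congʳ (+-congʳ x≈y))
    (solve 3 (λ y z w → (y :+ z) :+ (w :- z) := y :+ w) refl y z w))

  0≤+ : ∀ {x y} → 0# ≤ x → 0# ≤ y → 0# ≤ x + y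
  0≤+ p q = ≤-respˡ (+-identityˡ 0#) (+-mono-≤ p q)

  0<+ : ∀ {x y} → 0# < x → 0# ≤ y → 0# < x + y
  0<+ p q = <-respˡ-≈ (+-identityˡ 0#) (+-mono-<-≤ p q)

  0<* : ∀ {x y} → 0# < x → 0# < y → 0# < x * y
  0<* {x} {y} = *-pos x y

  0≤* : ∀ {x y} → 0# ≤ x → 0# ≤ y → 0# ≤ x * y
  0≤* (inj₁ p) (inj₁ q) = inj₁ (0<* p q)
  0≤* {x} {y} (inj₁ p) (inj₂ q) = inj₂ (sym (trans (*-congˡ (sym q)) (zeroʳ x)))
  0≤* {x} {y} (inj₂ p) q = inj₂ (sym (trans (*-congʳ (sym p)) (zeroˡ y)))

  *-monoˡ-≤ : ∀ {x y z} → 0# ≤ z → x ≤ y → z * x ≤ z * y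
  *-monoˡ-≤ {x} {y} {z} 0≤z x≤y = ≤-intro (0≤* 0≤z (≤-difference x≤y))
    (solve 3 (λ x y z → z :* x :+ z :* (y :- x) := z :* y) refl x y z)

  *-monoʳ-≤ : ∀ {x y z} → 0# ≤ z → x ≤ y → x * z ≤ y * z
  *-monoʳ-≤ 0≤z x≤y = ≤-respˡ (*-comm _ _) (≤-respʳ (*-comm _ _) (*-monoˡ-≤ 0≤z x≤y))

  *-monoˡ-< : ∀ {x y z} → 0# < z → x < y → z * x < z * y
  *-monoˡ-< {x} {y} {z} 0<z x<y = <-intro (0<* 0<z (<-difference x<y))
    (solve 3 (λ x y z → z :* x :+ z :* (y :- x) := z :* y) refl x y z)

  *-cancelˡ-≤ : ∀ {x y z} → 0# < z → z * x ≤ z * y → x ≤ y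
  *-cancelˡ-≤ 0<z p = ≮⇒≥ λ y<x → ≤⇒≯ p (*-monoˡ-< 0<z y<x)

  0<1 : 0# < 1#
  0<1 with compare 0# 1#
  ... | tri< 0<1 _ _ = 0<1
  ... | tri≈ _ 0≈1 _ = ⊥-elim (1≉0 (sym 0≈1))
  ... | tri> _ _ 1<0 = ⊥-elim (irrefl refl (<-trans 1<0
    (<-respʳ-≈ (solve 0 (:- con (+ 1) :* :- con (+ 1) := con (+ 1)) refl) (0<* 0<-1 0<-1))))
    where
    0<-1 : 0# < - 1#
    0<-1 = <-respʳ-≈ (+-identityˡ _) (<-difference 1<0)

  >⇒≉ : ∀ {x y} → y < x → ¬ x ≈ y
  >⇒≉ y<x x≈y = irrefl (sym x≈y) y<x

  *-⁻¹ : ∀ {x} → 0# < x → x * x ⁻¹ ≈ 1#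
  *-⁻¹ 0<x = *-inverse _ (>⇒≉ 0<x)

  0<⁻¹ : ∀ {x} → 0# < x → 0# < x ⁻¹
  0<⁻¹ {x} 0<x with <⊎≥ 0# (x ⁻¹)
  ... | inj₁ p = p
  ... | inj₂ x⁻¹≤0 = ⊥-elim (≤⇒≯ (≤-respˡ (*-⁻¹ 0<x) (≤-respʳ (zeroʳ x) (*-monoˡ-≤ (<⇒≤ 0<x) x⁻¹≤0))) 0<1)

  *-cancel-≈0 : ∀ {x y} → 0# < x → x * y ≈ 0# → y ≈ 0#
  *-cancel-≈0 {x} {y} 0<x eq = ≤-antisym
    (*-cancelˡ-≤ 0<x (≤-reflexive (trans eq (sym (zeroʳ x)))))
    (*-cancelˡ-≤ 0<x (≤-reflexive (trans (zeroʳ x) (sym eq))))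

  infixl 8 _/2
  _/2 : Carrier → Carrier
  x /2 = x * (1# + 1#) ⁻¹

  0<2 : 0# < 1# + 1#
  0<2 = 0<+ 0<1 (<⇒≤ 0<1)

  /2+/2 : ∀ x → x /2 + x /2 ≈ x
  /2+/2 x = trans (solve 2 (λ x h → x :* h :+ x :* h := x :* (con (+ 2) :* h)) refl x ((1# + 1#) ⁻¹))
    (trans (*-congˡ (*-⁻¹ 0<2)) (*-identityʳ x))

  0</2 : ∀ {x} → 0# < x → 0# < x /2
  0</2 0<x = 0<* 0<x (0<⁻¹ 0<2)

  <-dense : ∀ {x y} → x < y → ∃[ z ] (x < z × z < y)
  <-dense {x} {y} x<y = x + h ,
    <-intro 0<h refl ,
    <-intro 0<h (trans (+-assoc _ _ _) (trans (+-congˡ (/2+/2 (y - x)))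
      (solve 2 (λ x y → x :+ (y :- x) := y) refl x y)))
    where
    h = (y - x) /2
    0<h = 0</2 (<-difference x<y)

  infix 4 ∣_∣≤_
  -- Only upper bounds on absolute values are needed, so a relation replaces the function and
  -- estimates need no case split on signs.
  ∣_∣≤_ : Carrier → Carrier → Set
  ∣ x ∣≤ y = - y ≤ x × x ≤ y

  ∣∣≤-cong : ∀ {x x′ y y′} → x ≈ x′ → y ≈ y′ → ∣ x ∣≤ y → ∣ x′ ∣≤ y′
  ∣∣≤-cong p q (l , u) = ≤-respˡ (-‿cong q) (≤-respʳ p l) , ≤-respˡ p (≤-respʳ q u)

  ∣∣≤-trans : ∀ {x y z} → ∣ x ∣≤ y → y ≤ z → ∣ x ∣≤ z
  ∣∣≤-trans {x} {y} {z} (l , u) y≤z =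
    ≤-trans (≤-intro (≤-difference y≤z) (solve 2 (λ y z → :- z :+ (z :- y) := :- y) refl y z)) l ,
    ≤-trans u y≤z

  -- ∣∣≤ as two nonnegativity statements, the form in which it multiplies.
  ∣∣≤-difference : ∀ {x y} → ∣ x ∣≤ y → 0# ≤ y + x × 0# ≤ y - x
  ∣∣≤-difference {x} {y} (l , u) =
    ≤-respʳ (solve 2 (λ x y → x :- :- y := y :+ x) refl x y) (≤-difference l) , ≤-difference u

  ∣∣≤-intro : ∀ {x y} → 0# ≤ y + x → 0# ≤ y - x → ∣ x ∣≤ y
  ∣∣≤-intro {x} {y} p q =
    ≤-intro p (solve 2 (λ x y → :- y :+ (y :+ x) := x) refl x y) ,
    ≤-intro q (solve 2 (λ x y → x :+ (y :- x) := y) refl x y)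

  ∣∣≤⇒0≤ : ∀ {x y} → ∣ x ∣≤ y → 0# ≤ y
  ∣∣≤⇒0≤ {x} {y} b with ∣∣≤-difference b
  ... | p , q = *-cancelˡ-≤ 0<2 (≤-respˡ (sym (zeroʳ _)) (≤-respʳ
    (solve 2 (λ x y → (y :+ x) :+ (y :- x) := con (+ 2) :* y) refl x y) (0≤+ p q)))

  ∣∣≤-refl : ∀ {x} → 0# ≤ x → ∣ x ∣≤ x
  ∣∣≤-refl {x} 0≤x = ∣∣≤-intro (0≤+ 0≤x 0≤x) (≤-reflexive (sym (-‿inverseʳ x)))

  ∣∣≤-neg : ∀ {x y} → ∣ x ∣≤ y → ∣ - x ∣≤ y
  ∣∣≤-neg {x} {y} b with ∣∣≤-difference b
  ... | p , q = ∣∣≤-intro q (≤-respʳ (solve 2 (λ x y → y :+ x := y :- :- x) refl x y) p)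

  ∣∣≤-+ : ∀ {x y x′ y′} → ∣ x ∣≤ y → ∣ x′ ∣≤ y′ → ∣ x + x′ ∣≤ y + y′
  ∣∣≤-+ {x} {y} {x′} {y′} (l , u) (l′ , u′) =
    ≤-respˡ (solve 2 (λ y y′ → :- y :+ :- y′ := :- (y :+ y′)) refl y y′) (+-mono-≤ l l′) ,
    +-mono-≤ u u′

  -- Products of the nonnegative numbers `y ± x` and `y′ ± x′`, added in suitable pairs, give twice
  -- `y y′ ± x x′`; the mixed terms cancel.
  ∣∣≤-* : ∀ {x y x′ y′} → ∣ x ∣≤ y → ∣ x′ ∣≤ y′ → ∣ x * x′ ∣≤ y * y′
  ∣∣≤-* {x} {y} {x′} {y′} b b′ with ∣∣≤-difference b | ∣∣≤-difference b′
  ... | p , q | p′ , q′ = ∣∣≤-intro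
    (*-cancelˡ-≤ 0<2 (≤-respˡ (sym (zeroʳ _)) (≤-respʳ
      (solve 4 (λ x y x′ y′ → (y :+ x) :* (y′ :+ x′) :+ (y :- x) :* (y′ :- x′) := con (+ 2) :* (y :* y′ :+ x :* x′)) refl x y x′ y′)
      (0≤+ (0≤* p p′) (0≤* q q′)))))
    (*-cancelˡ-≤ 0<2 (≤-respˡ (sym (zeroʳ _)) (≤-respʳ
      (solve 4 (λ x y x′ y′ → (y :+ x) :* (y′ :- x′) :+ (y :- x) :* (y′ :+ x′) := con (+ 2) :* (y :* y′ :- x :* x′)) refl x y x′ y′)
      (0≤+ (0≤* p q′) (0≤* q p′)))))

  bound : ∀ x → ∃ (∣ x ∣≤_)
  bound x with <⊎≥ x 0#
  ... | inj₂ 0≤x = x , ∣∣≤-refl 0≤x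
  ... | inj₁ x<0 = - x , ∣∣≤-cong (solve 1 (λ x → :- :- x := x) refl x) refl
    (∣∣≤-neg (∣∣≤-refl (≤-respʳ (+-identityˡ _) (≤-difference (<⇒≤ x<0)))))

  0≤fromℕ : ∀ n → 0# ≤ fromℕ n
  0≤fromℕ zero    = ≤-refl
  0≤fromℕ (suc n) = 0≤+ (<⇒≤ 0<1) (0≤fromℕ n)

  0<fromℕ : ∀ {n} → 0 ℕ.< n → 0# < fromℕ n
  0<fromℕ {suc n} _ = 0<+ 0<1 (0≤fromℕ n)

  fromℕ-mono-≤ : ∀ {m n} → m ℕ.≤ n → fromℕ m ≤ fromℕ n
  fromℕ-mono-≤ {n = n} ℕ.z≤n = 0≤fromℕ n
  fromℕ-mono-≤ (ℕ.s≤s m≤n) = +-mono-≤ ≤-refl (fromℕ-mono-≤ m≤n)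

  fromℕ-mono-< : ∀ {m n} → m ℕ.< n → fromℕ m < fromℕ n
  fromℕ-mono-< {m} m<n = <-≤-trans (<-intro 0<1 (+-comm _ _)) (fromℕ-mono-≤ m<n)

  archimedean : ∀ x → ∃[ n ] x < fromℕ n
  archimedean x with <⊎≥ x 0#
  ... | inj₁ x<0 = 0 , x<0
  -- The set consists of the naturals up to `x`, so it is bounded by construction. A natural beyond
  -- `σ - 1` has a successor beyond `σ`; this successor is not in the set and hence exceeds `x`.
  ... | inj₂ 0≤x with sup (λ y → ∃[ n ] (y ≈ fromℕ n × y ≤ x)) (0# , 0 , refl , 0≤x) (x , λ _ → λ (_ , _ , y≤x) → y≤x)
  ...   | σ , upper , approx with approx (σ - 1#) (<-intro 0<1 (solve 1 (λ s → (s :- con (+ 1)) :+ con (+ 1) := s) refl σ))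
  ...     | y , (n , y≈n , _) , σ-1<y = suc n , x<n+1
    where
    σ<n+1 : σ < fromℕ (suc n)
    σ<n+1 = <-respˡ-≈ (solve 1 (λ s → con (+ 1) :+ (s :- con (+ 1)) := s) refl σ)
      (+-mono-≤-< ≤-refl (<-respʳ-≈ y≈n σ-1<y))
    x<n+1 : x < fromℕ (suc n)
    x<n+1 with <⊎≥ x (fromℕ (suc n))
    ... | inj₁ p = p
    ... | inj₂ n+1≤x = ⊥-elim (≤⇒≯ (upper _ (suc n , refl , n+1≤x)) σ<n+1)

  0≤^ : ∀ {t} → 0# ≤ t → ∀ n → 0# ≤ t ^ n
  0≤^ 0≤t zero    = <⇒≤ 0<1
  0≤^ 0≤t (suc n) = 0≤* 0≤t (0≤^ 0≤t n)

  0<^ : ∀ {t} → 0# < t → ∀ n → 0# < t ^ n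
  0<^ 0<t zero    = 0<1
  0<^ 0<t (suc n) = 0<* 0<t (0<^ 0<t n)

-- Binomial coefficients and finite sums.

C*k!*[n∸k]!≡n! : ∀ {n k} → k ℕ.≤ n → (n C k) ℕ.* (k ! ℕ.* (n ∸ k) !) ≡ n !
C*k!*[n∸k]!≡n! {n} {k} k≤n = ≡.trans (≡.cong (ℕ._* (k ! ℕ.* (n ∸ k) !)) (nCk≡n!/k![n-k]! k≤n)) (m/n*n≡m (k![n∸k]!∣n! k≤n))
  where instance _ = k ℕ.!* (n ∸ k) !≢0

module Summation (R : RealNumbers) where
  open OrderedField R public
  open Sum semiring public using (sum-cong-≋; ∑-distrib-+; ∑-comm; *-distribˡ-sum; *-distribʳ-sum; sum-replicate-zero)

  sum-mono-≤ : ∀ {n} {f g : Fin n → Carrier} → (∀ i → f i ≤ g i) → sum f ≤ sum g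
  sum-mono-≤ {zero}  p = ≤-refl
  sum-mono-≤ {suc n} p = +-mono-≤ (p zero) (sum-mono-≤ (p ∘ suc))

  0≤sum : ∀ {n} {f : Fin n → Carrier} → (∀ i → 0# ≤ f i) → 0# ≤ sum f
  0≤sum {zero}  p = ≤-refl
  0≤sum {suc n} p = 0≤+ (p zero) (0≤sum (p ∘ suc))

  sum-∣∣≤ : ∀ {n} {f g : Fin n → Carrier} → (∀ i → ∣ f i ∣≤ g i) → ∣ sum f ∣≤ sum g
  sum-∣∣≤ {zero}  p = ∣∣≤-refl ≤-refl
  sum-∣∣≤ {suc n} p = ∣∣≤-+ (p zero) (sum-∣∣≤ (p ∘ suc))

  -- Summands defined on all of ℕ let sums of different lengths share one summand, as the partial
  -- sums of a series do.
  Σ : ℕ → (ℕ → Carrier) → Carrier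
  Σ N f = sum {N} (λ i → f (toℕ i))

  Σ-cong : ∀ N {f g} → (∀ i → i ℕ.< N → f i ≈ g i) → Σ N f ≈ Σ N g
  Σ-cong N p = sum-cong-≋ {N} (λ i → p (toℕ i) (Fin.toℕ<n i))

  Σ-mono-≤ : ∀ N {f g} → (∀ i → i ℕ.< N → f i ≤ g i) → Σ N f ≤ Σ N g
  Σ-mono-≤ N p = sum-mono-≤ {N} (λ i → p (toℕ i) (Fin.toℕ<n i))

  Σ-snoc : ∀ N f → Σ (suc N) f ≈ Σ N f + f N
  Σ-snoc zero    f = +-comm _ _
  Σ-snoc (suc N) f = trans (+-congˡ (Σ-snoc N (f ∘ suc))) (sym (+-assoc _ _ _))

  Σ-monoˡ-≤ : ∀ {M N f} → M ℕ.≤ N → (∀ i → 0# ≤ f i) → Σ M f ≤ Σ N f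
  Σ-monoˡ-≤ {N = N} ℕ.z≤n p = 0≤sum {N} (λ i → p (toℕ i))
  Σ-monoˡ-≤ (ℕ.s≤s M≤N) p = +-mono-≤ ≤-refl (Σ-monoˡ-≤ M≤N (λ i → p (suc i)))

  Σ-+ : ∀ N f g → Σ N (λ i → f i + g i) ≈ Σ N f + Σ N g
  Σ-+ N f g = ∑-distrib-+ {N} (λ i → f (toℕ i)) (λ i → g (toℕ i))

  Σ-*ʳ : ∀ N f x → Σ N f * x ≈ Σ N (λ i → f i * x)
  Σ-*ʳ N f x = *-distribʳ-sum {N} x (λ i → f (toℕ i))

-- Limits of sequences.

module Limits (R : RealNumbers) where
  open Summation R public

  ⟶-elim : ∀ {f l} → f ⟶ l → ∀ ε → 0# < ε → ∃[ N ] (∀ n → N ℕ.≤ n → ∣ f n - l ∣≤ ε)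
  ⟶-elim {f} {l} lim ε 0<ε with lim ε 0<ε
  ... | N , p = N , λ n N≤n →
    ≤-intro (≤-difference (<⇒≤ (proj₂ (p n N≤n))))
      (solve 3 (λ e x l → :- e :+ (e :- (l :- x)) := x :- l) refl ε (f n) l) ,
    <⇒≤ (proj₁ (p n N≤n))

  ⟶-intro : ∀ {f l} → (∀ ε → 0# < ε → ∃[ N ] (∀ n → N ℕ.≤ n → ∣ f n - l ∣≤ ε)) → f ⟶ l
  -- `ε /2` leaves room to pass from the weak bound to the strict inequalities of `_⟶_`.
  ⟶-intro {f} {l} lim ε 0<ε with lim (ε /2) (0</2 0<ε)
  ... | N , p = N , λ n N≤n →
    ≤-<-trans (proj₂ (p n N≤n)) half< ,
    ≤-<-trans (proj₂ (∣∣≤-cong (solve 2 (λ x l → :- (x :- l) := l :- x) refl (f n) l) refl (∣∣≤-neg (p n N≤n)))) half<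
    where
    half< : ε /2 < ε
    half< = <-intro (0</2 0<ε) (/2+/2 ε)

  ⟶-cong : ∀ {f g l m} → (∀ n → f n ≈ g n) → l ≈ m → f ⟶ l → g ⟶ m
  ⟶-cong f≈g l≈m lim ε 0<ε with lim ε 0<ε
  ... | N , p = N , λ n N≤n →
    <-respˡ-≈ (+-cong (f≈g n) (-‿cong l≈m)) (proj₁ (p n N≤n)) ,
    <-respˡ-≈ (+-cong l≈m (-‿cong (f≈g n))) (proj₂ (p n N≤n))

  ≤-by-ε : ∀ {x y} → (∀ ε → 0# < ε → x ≤ y + ε) → x ≤ y
  ≤-by-ε {x} {y} p = ≮⇒≥ λ y<x → let z , y<z , z<x = <-dense y<x in
    ≤⇒≯ (p (z - y) (<-difference y<z)) (<-respˡ-≈ (solve 2 (λ y z → z := y :+ (z :- y)) refl y z) z<x)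

  ⟶-unique-≤ : ∀ {f l m} → f ⟶ l → f ⟶ m → l ≤ m
  ⟶-unique-≤ {f} {l} {m} p q = ≤-by-ε λ ε 0<ε →
    let N , pN = ⟶-elim p (ε /2) (0</2 0<ε)
        M , qM = ⟶-elim q (ε /2) (0</2 0<ε)
        n = N ℕ.+ M
        d = ∣∣≤-+ (∣∣≤-neg (pN n (ℕ.m≤m+n N M))) (qM n (ℕ.m≤n+m M N))
    in ≤-intro (≤-difference (≤-respʳ (/2+/2 ε) (proj₂ d)))
         (solve 4 (λ e l m x → l :+ (e :- (:- (x :- l) :+ (x :- m))) := m :+ e) refl ε l m (f n))

  ⟶-unique : ∀ {f l m} → f ⟶ l → f ⟶ m → l ≈ m
  ⟶-unique p q = ≤-antisym (⟶-unique-≤ p q) (⟶-unique-≤ q p)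

  ⟶-* : ∀ {f g x y} → f ⟶ x → g ⟶ y → (λ n → f n * g n) ⟶ x * y
  ⟶-* {f} {g} {x} {y} p q = ⟶-intro λ ε 0<ε →
    let X , ∣x∣≤X = bound x
        Y , ∣y∣≤Y = bound y
        D = 1# + (X + Y)
        0<D = 0<+ 0<1 (0≤+ (∣∣≤⇒0≤ ∣x∣≤X) (∣∣≤⇒0≤ ∣y∣≤Y))
        0<ε+D = 0<+ 0<ε (<⇒≤ 0<D)
        -- Chosen so that `δ ≤ 1#` and `δ * (ε + D) ≈ ε`: the error `δ² + X δ + δ Y` is then at most
        -- `δ D`, hence at most `ε`.
        δ = ε * (ε + D) ⁻¹
        0<δ = 0<* 0<ε (0<⁻¹ 0<ε+D)
        δ[ε+D]≈ε = trans (solve 3 (λ e d i → e :* i :* (e :+ d) := e :* ((e :+ d) :* i)) refl ε D ((ε + D) ⁻¹))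
                     (trans (*-congˡ (*-⁻¹ 0<ε+D)) (*-identityʳ ε))
        δ≤1 = *-cancelˡ-≤ 0<ε+D (≤-intro (<⇒≤ 0<D)
                (trans (+-congʳ (trans (*-comm _ _) δ[ε+D]≈ε)) (sym (*-identityʳ _))))
        N , pN = ⟶-elim p δ 0<δ
        M , qM = ⟶-elim q δ 0<δ
    in N ℕ.+ M , λ n N+M≤n →
      let ∣f-x∣ = pN n (ℕ.≤-trans (ℕ.m≤m+n N M) N+M≤n)
          ∣g-y∣ = qM n (ℕ.≤-trans (ℕ.m≤n+m M N) N+M≤n)
      in ∣∣≤-trans
           (∣∣≤-cong (solve 4 (λ f g x y → (f :- x) :* (g :- y) :+ (x :* (g :- y) :+ (f :- x) :* y) := f :* g :- x :* y) refl (f n) (g n) x y) refl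
             (∣∣≤-+ (∣∣≤-* ∣f-x∣ ∣g-y∣) (∣∣≤-+ (∣∣≤-* ∣x∣≤X ∣g-y∣) (∣∣≤-* ∣f-x∣ ∣y∣≤Y))))
           (≤-intro (0≤+ (0≤* (<⇒≤ 0<δ) (<⇒≤ 0<ε)) (0≤* (<⇒≤ 0<δ) (≤-difference δ≤1)))
             (trans (solve 4 (λ d e x y → d :* d :+ (x :* d :+ d :* y) :+ (d :* e :+ d :* (con (+ 1) :- d)) := d :* (e :+ (con (+ 1) :+ (x :+ y)))) refl δ ε X Y)
               δ[ε+D]≈ε))

  ⟶-squeeze : ∀ {f g h l} → f ⟶ l → h ⟶ 0# → (∀ n → ∣ f n - g n ∣≤ h n) → g ⟶ l
  ⟶-squeeze {f} {g} {h} {l} p q f-g = ⟶-intro λ ε 0<ε →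
    let N , pN = ⟶-elim p (ε /2) (0</2 0<ε)
        M , qM = ⟶-elim q (ε /2) (0</2 0<ε)
    in N ℕ.+ M , λ n N+M≤n → ∣∣≤-cong
      (solve 3 (λ f g l → (f :- l) :+ :- (f :- g) := g :- l) refl (f n) (g n) l) (/2+/2 ε)
      (∣∣≤-+ (pN n (ℕ.≤-trans (ℕ.m≤m+n N M) N+M≤n))
        (∣∣≤-neg (∣∣≤-trans (f-g n) (≤-respˡ (solve 1 (λ h → h :- con (+ 0) := h) refl (h n))
          (proj₂ (qM n (ℕ.≤-trans (ℕ.m≤n+m M N) N+M≤n)))))))

  -- Supplies the null sequence in the addition theorem: for nonnegative arguments the product of
  -- two partial sums of length `n` lies between the partial sums of lengths `n` and `2n` of the
  -- combined series.
  ⟶-doubling : ∀ {f l} → f ⟶ l → (λ n → f (n ℕ.+ n) - f n) ⟶ 0#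
  ⟶-doubling {f} {l} p = ⟶-intro λ ε 0<ε →
    let N , pN = ⟶-elim p (ε /2) (0</2 0<ε)
    in N , λ n N≤n → ∣∣≤-cong
      (solve 3 (λ x y l → (x :- l) :+ :- (y :- l) := x :- y :- con (+ 0)) refl (f (n ℕ.+ n)) (f n) l) (/2+/2 ε)
      (∣∣≤-+ (pN (n ℕ.+ n) (ℕ.≤-trans N≤n (ℕ.m≤m+n n n))) (∣∣≤-neg (pN n N≤n)))

  ⟶-≥ : ∀ {f l x} N → f ⟶ l → (∀ n → N ℕ.≤ n → x ≤ f n) → x ≤ l
  ⟶-≥ {f} {l} {x} N p q = ≤-by-ε λ ε 0<ε →
    let M , pM = ⟶-elim p ε 0<ε
    in ≤-trans (q (N ℕ.+ M) (ℕ.m≤m+n N M))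
      (≤-intro (≤-difference (proj₂ (pM (N ℕ.+ M) (ℕ.m≤n+m M N))))
        (solve 3 (λ f l e → f :+ (e :- (f :- l)) := l :+ e) refl (f (N ℕ.+ M)) l ε))

  monotone-bounded : ∀ {f u} → (∀ {m n} → m ℕ.≤ n → f m ≤ f n) → (∀ n → f n ≤ u) → ∃[ l ] f ⟶ l
  monotone-bounded {f} {u} mono f≤u with sup (λ x → ∃[ n ] x ≈ f n) (f 0 , 0 , refl)
      (u , λ x → λ (n , x≈fn) → ≤-respˡ (sym x≈fn) (f≤u n))
  ... | σ , upper , approx = σ , ⟶-intro λ ε 0<ε →
    let x , (N , x≈fN) , σ-ε<x = approx (σ - ε) (<-intro 0<ε (solve 2 (λ s e → (s :- e) :+ e := s) refl σ ε))
    in N , λ n N≤n → ∣∣≤-intro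
      (≤-respʳ (solve 3 (λ f s e → f :- (s :- e) := e :+ (f :- s)) refl (f n) σ ε)
        (≤-difference (≤-trans (<⇒≤ σ-ε<x) (≤-respˡ (sym x≈fN) (mono N≤n)))))
      (≤-respʳ (solve 3 (λ f s e → e :+ (s :- f) := e :- (f :- s)) refl (f n) σ ε)
        (0≤+ (<⇒≤ 0<ε) (≤-difference (upper (f n) (n , refl)))))

-- The exponential series and its addition theorem.

module Exponential (R : RealNumbers) where
  open Limits R public
  open Mult semiring using (×-assoc-*; ×1-homo-*) renaming (×-congʳ to ·-congʳ)
  open Exp semiring public using (^-congˡ)
  open import Relation.Binary.Reasoning.Setoid setoid

  term : Carrier → ℕ → Carrier
  term x n = x ^ n * fromℕ (n !) ⁻¹

  partial : ℕ → Carrier → Carrier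
  partial N x = Σ N (term x)

  ⁻¹-unique : ∀ {x y} → 0# < x → x * y ≈ 1# → y ≈ x ⁻¹
  ⁻¹-unique {x} {y} 0<x xy≈1 = begin
    y                 ≈⟨ *-identityˡ y ⟨
    1# * y            ≈⟨ *-congʳ (*-⁻¹ 0<x) ⟨
    x * x ⁻¹ * y      ≈⟨ solve 3 (λ x i y → x :* i :* y := (x :* y) :* i) refl x (x ⁻¹) y ⟩
    x * y * x ⁻¹      ≈⟨ *-congʳ xy≈1 ⟩
    1# * x ⁻¹         ≈⟨ *-identityˡ _ ⟩
    x ⁻¹              ∎

  0<! : ∀ n → 0# < fromℕ (n !)
  0<! n = 0<fromℕ (ℕ.1≤n! n)

  !⁻¹-suc : ∀ n → fromℕ (suc n !) ⁻¹ ≈ fromℕ (suc n) ⁻¹ * fromℕ (n !) ⁻¹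
  !⁻¹-suc n = sym (⁻¹-unique (0<! (suc n)) (begin
    fromℕ (suc n !) * (a ⁻¹ * b ⁻¹)     ≈⟨ *-congʳ (×1-homo-* (suc n) (n !)) ⟩
    (a * b) * (a ⁻¹ * b ⁻¹)             ≈⟨ solve 4 (λ a b c d → (a :* b) :* (c :* d) := (a :* c) :* (b :* d)) refl a b (a ⁻¹) (b ⁻¹) ⟩
    (a * a ⁻¹) * (b * b ⁻¹)             ≈⟨ *-cong (*-⁻¹ (0<fromℕ {suc n} (ℕ.s≤s ℕ.z≤n))) (*-⁻¹ (0<! n)) ⟩
    1# * 1#                             ≈⟨ *-identityʳ 1# ⟩
    1#                                  ∎))
    where
    a = fromℕ (suc n)
    b = fromℕ (n !)

  term-suc : ∀ x n → term x (suc n) ≈ term x n * (x * fromℕ (suc n) ⁻¹)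
  term-suc x n = trans (*-congˡ (!⁻¹-suc n))
    (solve 4 (λ x p a b → (x :* p) :* (a :* b) := p :* b :* (x :* a)) refl x (x ^ n) (fromℕ (suc n) ⁻¹) (fromℕ (n !) ⁻¹))

  ∣∣≤-^ : ∀ {x y} → ∣ x ∣≤ y → ∀ n → ∣ x ^ n ∣≤ y ^ n
  ∣∣≤-^ b zero    = ∣∣≤-refl (<⇒≤ 0<1)
  ∣∣≤-^ b (suc n) = ∣∣≤-* b (∣∣≤-^ b n)

  ∣∣≤-term : ∀ {x y} → ∣ x ∣≤ y → ∀ n → ∣ term x n ∣≤ term y n
  ∣∣≤-term b n = ∣∣≤-* (∣∣≤-^ b n) (∣∣≤-refl (<⇒≤ (0<⁻¹ (0<! n))))

  0≤term : ∀ {x} → 0# ≤ x → ∀ n → 0# ≤ term x n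
  0≤term 0≤x n = ∣∣≤⇒0≤ (∣∣≤-term (∣∣≤-refl 0≤x) n)

  partial-mono-≤ : ∀ {x} → 0# ≤ x → ∀ {M N} → M ℕ.≤ N → partial M x ≤ partial N x
  partial-mono-≤ 0≤x M≤N = Σ-monoˡ-≤ M≤N (0≤term 0≤x)

  ∣∣≤-partial-difference : ∀ {x y} → ∣ x ∣≤ y → ∀ {M N} → M ℕ.≤ N →
    ∣ partial N x - partial M x ∣≤ partial N y - partial M y
  ∣∣≤-partial-difference {x} {y} b {M} M≤N with ℕ.≤⇒≤′ M≤N
  ... | M≤′N = go M≤′N
    where
    go : ∀ {N} → M ℕ.≤′ N → ∣ partial N x - partial M x ∣≤ partial N y - partial M y
    go (ℕ.≤′-reflexive ≡.refl) = ∣∣≤-cong (sym (-‿inverseʳ _)) (sym (-‿inverseʳ _)) (∣∣≤-refl ≤-refl)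
    go (ℕ.≤′-step {N} M≤N) = ∣∣≤-cong (regroup x) (regroup y) (∣∣≤-+ (go M≤N) (∣∣≤-term b N))
      where
      regroup : ∀ z → (partial N z - partial M z) + term z N ≈ partial (suc N) z - partial M z
      regroup z = trans (solve 3 (λ p q t → (p :- q) :+ t := (p :+ t) :- q) refl (partial N z) (partial M z) (term z N))
        (+-congʳ (sym (Σ-snoc N (term z))))

  C*!⁻¹ : ∀ {n k} → k ℕ.≤ n → fromℕ (n C k) * fromℕ (n !) ⁻¹ ≈ fromℕ (k !) ⁻¹ * fromℕ ((n ∸ k) !) ⁻¹
  C*!⁻¹ {n} {k} k≤n = begin
    c * n! ⁻¹                                           ≈⟨ *-identityʳ _ ⟨
    c * n! ⁻¹ * 1#                                      ≈⟨ *-congˡ (trans (*-cong (*-⁻¹ (0<! k)) (*-⁻¹ (0<! (n ∸ k)))) (*-identityʳ 1#)) ⟨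
    c * n! ⁻¹ * ((k! * k! ⁻¹) * (m! * m! ⁻¹))           ≈⟨ solve 6 (λ c i k k′ m m′ → c :* i :* ((k :* k′) :* (m :* m′)) := (c :* (k :* m)) :* i :* (k′ :* m′)) refl c (n! ⁻¹) k! (k! ⁻¹) m! (m! ⁻¹) ⟩
    (c * (k! * m!)) * n! ⁻¹ * (k! ⁻¹ * m! ⁻¹)           ≈⟨ *-congʳ (*-congʳ (trans (×1-homo-* (n C k) _) (*-congˡ (×1-homo-* (k !) ((n ∸ k) !))))) ⟨
    fromℕ ((n C k) ℕ.* (k ! ℕ.* (n ∸ k) !)) * n! ⁻¹ * (k! ⁻¹ * m! ⁻¹)  ≡⟨ ≡.cong (λ l → fromℕ l * n! ⁻¹ * (k! ⁻¹ * m! ⁻¹)) (C*k!*[n∸k]!≡n! k≤n) ⟩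
    n! * n! ⁻¹ * (k! ⁻¹ * m! ⁻¹)                        ≈⟨ *-congʳ (*-⁻¹ (0<! n)) ⟩
    1# * (k! ⁻¹ * m! ⁻¹)                                ≈⟨ *-identityˡ _ ⟩
    k! ⁻¹ * m! ⁻¹                                       ∎
    where
    c = fromℕ (n C k)
    n! = fromℕ (n !)
    k! = fromℕ (k !)
    m! = fromℕ ((n ∸ k) !)

  -- The binomial theorem divided by `n !`, read as the evaluation of one diagonal of the Cauchy
  -- product.
  term-+ : ∀ x y n → Σ (suc n) (λ k → term x k * term y (n ∸ k)) ≈ term (x + y) n
  term-+ x y n = begin
    Σ (suc n) (λ k → term x k * term y (n ∸ k))
      ≈⟨ Σ-cong (suc n) (λ k k<1+n → same-term k (ℕ.≤-pred k<1+n)) ⟩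
    Σ (suc n) (λ k → (n C k) · (x ^ k * y ^ (n ∸ k)) * fromℕ (n !) ⁻¹)
      ≈⟨ Σ-*ʳ (suc n) (λ k → (n C k) · (x ^ k * y ^ (n ∸ k))) _ ⟨
    Σ (suc n) (λ k → (n C k) · (x ^ k * y ^ (n ∸ k))) * fromℕ (n !) ⁻¹
      ≈⟨ *-congʳ (Binomial.theorem commutativeSemiring n x y) ⟨
    (x + y) ^ n * fromℕ (n !) ⁻¹
      ∎
    where
    same-term : ∀ k → k ℕ.≤ n → term x k * term y (n ∸ k) ≈ (n C k) · (x ^ k * y ^ (n ∸ k)) * fromℕ (n !) ⁻¹
    same-term k k≤n = begin
      x ^ k * i * (y ^ (n ∸ k) * j)                        ≈⟨ solve 4 (λ p i q j → p :* i :* (q :* j) := (i :* j) :* (p :* q)) refl (x ^ k) i (y ^ (n ∸ k)) j ⟩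
      (i * j) * (x ^ k * y ^ (n ∸ k))                      ≈⟨ *-congʳ (C*!⁻¹ k≤n) ⟨
      (fromℕ (n C k) * fromℕ (n !) ⁻¹) * (x ^ k * y ^ (n ∸ k))  ≈⟨ solve 3 (λ c f p → (c :* f) :* p := (c :* p) :* f) refl (fromℕ (n C k)) (fromℕ (n !) ⁻¹) (x ^ k * y ^ (n ∸ k)) ⟩
      (fromℕ (n C k) * (x ^ k * y ^ (n ∸ k))) * fromℕ (n !) ⁻¹  ≈⟨ *-congʳ (trans (×-assoc-* (n C k) 1# _) (·-congʳ (n C k) (*-identityˡ _))) ⟩
      (n C k) · (x ^ k * y ^ (n ∸ k)) * fromℕ (n !) ⁻¹  ∎
      where
      i = fromℕ (k !) ⁻¹
      j = fromℕ ((n ∸ k) !) ⁻¹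

  -- The left side sums `term x i * term y j` over the triangle `i + j < N`. Increasing `N` by one
  -- adds the diagonal `i + j = N`, which `term-+` evaluates.
  partial-+ : ∀ x y N → Σ N (λ i → term x i * partial (N ∸ i) y) ≈ partial N (x + y)
  partial-+ x y zero    = refl
  partial-+ x y (suc N) = begin
    Σ (suc N) (λ i → term x i * partial (suc N ∸ i) y)
      ≈⟨ Σ-cong (suc N) (λ i i<1+N → peel i (ℕ.≤-pred i<1+N)) ⟩
    Σ (suc N) (λ i → a i + b i)
      ≈⟨ Σ-+ (suc N) a b ⟩
    Σ (suc N) a + Σ (suc N) b
      ≈⟨ +-cong (Σ-snoc N a) (term-+ x y N) ⟩
    Σ N a + term x N * partial (N ∸ N) y + term (x + y) N
      ≈⟨ +-congʳ (trans (+-cong (partial-+ x y N)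
           (trans (*-congˡ (reflexive (≡.cong (λ m → partial m y) (ℕ.n∸n≡0 N)))) (zeroʳ _))) (+-identityʳ _)) ⟩
    partial N (x + y) + term (x + y) N
      ≈⟨ Σ-snoc N (term (x + y)) ⟨
    partial (suc N) (x + y)
      ∎
    where
    a b : ℕ → Carrier
    a i = term x i * partial (N ∸ i) y
    b i = term x i * term y (N ∸ i)
    peel : ∀ i → i ℕ.≤ N → term x i * partial (suc N ∸ i) y ≈ term x i * partial (N ∸ i) y + term x i * term y (N ∸ i)
    peel i i≤N = begin
      term x i * partial (suc N ∸ i) y                       ≡⟨ ≡.cong (λ m → term x i * partial m y) (ℕ.+-∸-assoc 1 i≤N) ⟩
      term x i * partial (suc (N ∸ i)) y                     ≈⟨ *-congˡ (Σ-snoc (N ∸ i) (term y)) ⟩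
      term x i * (partial (N ∸ i) y + term y (N ∸ i))        ≈⟨ distribˡ _ _ _ ⟩
      term x i * partial (N ∸ i) y + term x i * term y (N ∸ i)  ∎

  -- The square `i, j < N` without the triangle `i + j < N`, written with tails of the series in `y`
  -- so that it can be bounded term by term.
  product-defect : ∀ x y N → partial N x * partial N y - partial N (x + y) ≈
    Σ N (λ i → term x i * (partial N y - partial (N ∸ i) y))
  product-defect x y N = begin
    partial N x * partial N y - partial N (x + y)
      ≈⟨ +-cong (Σ-*ʳ N (term x) _) (-‿cong (sym (partial-+ x y N))) ⟩
    S - Σ N b
      ≈⟨ +-congʳ S≈ ⟩
    (Σ N a + Σ N b) - Σ N b
      ≈⟨ solve 2 (λ s t → (s :+ t) :- t := s) refl (Σ N a) (Σ N b) ⟩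
    Σ N a
      ∎
    where
    S = Σ N (λ i → term x i * partial N y)
    a b : ℕ → Carrier
    a i = term x i * (partial N y - partial (N ∸ i) y)
    b i = term x i * partial (N ∸ i) y
    S≈ : S ≈ Σ N a + Σ N b
    S≈ = trans (Σ-cong N (λ i _ → solve 3 (λ t p q → t :* p := t :* (p :- q) :+ t :* q) refl (term x i) (partial N y) (partial (N ∸ i) y)))
      (Σ-+ N a b)

  ∣∣≤-product-defect : ∀ {x y a b} → ∣ x ∣≤ a → ∣ y ∣≤ b → ∀ N →
    ∣ partial N x * partial N y - partial N (x + y) ∣≤ partial N a * partial N b - partial N (a + b)
  ∣∣≤-product-defect x≤a y≤b N = ∣∣≤-cong (sym (product-defect _ _ N)) (sym (product-defect _ _ N))
    (sum-∣∣≤ {N} λ i → ∣∣≤-* (∣∣≤-term x≤a (toℕ i)) (∣∣≤-partial-difference y≤b (ℕ.m∸n≤m N (toℕ i))))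

  -- The square `i, j < N` lies in the triangle `i + j < N + N`, and all terms are nonnegative.
  partial-*-≤ : ∀ {a b} → 0# ≤ a → 0# ≤ b → ∀ N → partial N a * partial N b ≤ partial (N ℕ.+ N) (a + b)
  partial-*-≤ {a} {b} 0≤a 0≤b N = ≤-respˡ (sym (Σ-*ʳ N (term a) _)) (≤-respʳ (partial-+ a b (N ℕ.+ N)) (≤-trans
    (Σ-mono-≤ N λ i i<N → *-monoˡ-≤ (0≤term 0≤a i) (partial-mono-≤ 0≤b (N≤N+N∸i i i<N)))
    (Σ-monoˡ-≤ (ℕ.m≤m+n N N) λ i → 0≤* (0≤term 0≤a i) (0≤sum {N ℕ.+ N ∸ i} λ j → 0≤term 0≤b (toℕ j)))))
    where
    N≤N+N∸i : ∀ i → i ℕ.< N → N ℕ.≤ N ℕ.+ N ∸ i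
    N≤N+N∸i i i<N = ℕ.≤-trans (ℕ.m≤m+n N (N ∸ i)) (ℕ.≤-reflexive (≡.sym (ℕ.+-∸-assoc N (ℕ.<⇒≤ i<N))))

  -- Once the index exceeds `2 x`, each term is at most half of the preceding one, so a partial sum
  -- plus twice the next term no longer grows.
  partial-bounded : ∀ {x} → 0# ≤ x → ∃[ u ] (∀ n → partial n x ≤ u)
  partial-bounded {x} 0≤x with archimedean (x + x)
  ... | m , 2x<m = partial m x + (term x m + term x m) , λ n →
    ≤-trans (partial-mono-≤ 0≤x (ℕ.m≤n+m n m))
      (≤-trans (≤-intro (0≤+ (0≤term 0≤x (m ℕ.+ n)) (0≤term 0≤x (m ℕ.+ n))) refl) (decreasing n))
    where
    2term-suc≤term : ∀ n → m ℕ.≤ suc n → term x (suc n) + term x (suc n) ≤ term x n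
    2term-suc≤term n m≤1+n = ≤-respˡ (sym (trans (+-cong (term-suc x n) (term-suc x n))
        (solve 3 (λ t x i → t :* (x :* i) :+ t :* (x :* i) := t :* (i :* (x :+ x))) refl (term x n) x (fromℕ (suc n) ⁻¹))))
      (≤-respʳ (*-identityʳ _) (*-monoˡ-≤ (0≤term 0≤x n) (≤-respʳ (trans (*-comm _ _) (*-⁻¹ 0<1+n))
        (*-monoˡ-≤ (<⇒≤ (0<⁻¹ 0<1+n)) (≤-trans (<⇒≤ 2x<m) (fromℕ-mono-≤ m≤1+n))))))
      where 0<1+n = 0<fromℕ {suc n} (ℕ.s≤s ℕ.z≤n)

    decreasing : ∀ n → partial (m ℕ.+ n) x + (term x (m ℕ.+ n) + term x (m ℕ.+ n)) ≤ partial m x + (term x m + term x m)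
    decreasing zero rewrite ℕ.+-identityʳ m = ≤-refl
    decreasing (suc n) rewrite ℕ.+-suc m n = ≤-trans
      (≤-respˡ (sym (trans (+-congʳ (Σ-snoc (m ℕ.+ n) (term x))) (+-assoc _ _ _)))
        (+-mono-≤ ≤-refl (+-mono-≤ ≤-refl (2term-suc≤term (m ℕ.+ n) (ℕ.m≤n⇒m≤1+n (ℕ.m≤m+n m n))))))
      (decreasing n)

  exp-exists : ∀ {x} → 0# ≤ x → ∃[ y ] IsExp x y
  exp-exists 0≤x = monotone-bounded (partial-mono-≤ 0≤x) (proj₂ (partial-bounded 0≤x))

  -- Signs are removed by passing to bounds `a` and `b`; for these the defect is at most `partial (N
  -- + N) (a + b) - partial N (a + b)`, which tends to 0 because the series converges.
  IsExp-+ : ∀ {x y p q} → IsExp x p → IsExp y q → IsExp (x + y) (p * q)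
  IsExp-+ {x} {y} px qy =
    let a , x≤a = bound x
        b , y≤b = bound y
        0≤a = ∣∣≤⇒0≤ x≤a
        0≤b = ∣∣≤⇒0≤ y≤b
    in ⟶-squeeze (⟶-* px qy) (⟶-doubling (proj₂ (exp-exists (0≤+ 0≤a 0≤b)))) λ N →
      ∣∣≤-trans (∣∣≤-product-defect x≤a y≤b N)
        (+-mono-≤ (partial-*-≤ 0≤a 0≤b N) ≤-refl)

  IsExp-cong : ∀ {x y p q} → x ≈ y → p ≈ q → IsExp x p → IsExp y q
  IsExp-cong {x} {y} x≈y = ⟶-cong λ N → Σ-cong N {term x} {term y} λ i _ → *-congʳ (^-congˡ i x≈y)

  term-0 : ∀ x → term x 0 ≈ 1#
  term-0 x = trans (*-identityˡ _) (sym (⁻¹-unique (0<! 0) (trans (*-identityʳ _) (+-identityʳ 1#))))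

  term-1 : ∀ x → term x 1 ≈ x
  term-1 x = trans (term-suc x 0) (trans (*-cong (term-0 x) (*-congˡ (sym (⁻¹-unique (0<! 1) (trans (*-identityʳ _) (+-identityʳ 1#))))))
    (solve 1 (λ x → con (+ 1) :* (x :* con (+ 1)) := x) refl x))

  1+x≤exp : ∀ {x y} → 0# ≤ x → IsExp x y → 1# + x ≤ y
  1+x≤exp {x} 0≤x p = ⟶-≥ 2 p λ n 2≤n →
    ≤-respˡ (trans (+-congˡ (+-identityʳ _)) (+-cong (term-0 x) (term-1 x))) (partial-mono-≤ 0≤x 2≤n)

  IsExp-0 : IsExp 0# 1#
  -- The empty partial sum is `0#`; the value `1#` is constant only from length 1 on.
  IsExp-0 = ⟶-intro λ ε 0<ε → 1 , λ where
      (suc n) _ → ∣∣≤-cong (sym (constant n)) refl (∣∣≤-trans (∣∣≤-refl ≤-refl) (<⇒≤ 0<ε))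
    where
    constant : ∀ n → partial (suc n) 0# - 1# ≈ 0#
    constant n = trans (+-congʳ (+-cong (term-0 0#) (trans (Σ-cong n {λ i → term 0# (suc i)} {λ _ → 0#} (λ i _ →
        trans (*-congʳ (zeroˡ _)) (zeroˡ _))) (sum-replicate-zero n))))
      (solve 0 (con (+ 1) :+ con (+ 0) :- con (+ 1) := con (+ 0)) refl)

  IsExp-· : ∀ {x p} → IsExp x p → ∀ n → IsExp (fromℕ n * x) (p ^ n)
  IsExp-· px zero = IsExp-cong (sym (zeroˡ _)) refl IsExp-0
  IsExp-· {x} px (suc n) = IsExp-cong
    (solve 2 (λ x n → x :+ n :* x := (con (+ 1) :+ n) :* x) refl x (fromℕ n)) refl
    (IsExp-+ px (IsExp-· px n))

  -- If `y < x`, then `p` is `q` times the exponential of `x - y`, which exceeds 1 by `1+x≤exp`.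
  -- Only the exponential of this positive difference has to be constructed.
  exp-cancel-≤ : ∀ {x y p q} → IsExp x p → IsExp y q → 0# < p → p ≤ q → x ≤ y
  exp-cancel-≤ {x} {y} {p} {q} px qy 0<p p≤q = ≮⇒≥ λ y<x →
    let 0<x-y = <-difference y<x
        r , re = exp-exists (<⇒≤ 0<x-y)
        1<r = <-≤-trans (<-intro 0<x-y refl) (1+x≤exp (<⇒≤ 0<x-y) re)
        p≈qr = ⟶-unique px (IsExp-cong (solve 2 (λ x y → y :+ (x :- y) := x) refl x y) refl (IsExp-+ qy re))
    in ≤⇒≯ p≤q (<-respʳ-≈ (sym p≈qr) (<-respˡ-≈ (*-identityʳ q) (*-monoˡ-< (<-≤-trans 0<p p≤q) 1<r)))

-- Coding disjoint unions of finite sets.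

sumℕ : ∀ {n} → (Fin n → ℕ) → ℕ
sumℕ = Vector.foldr ℕ._+_ 0

inject : ∀ {n} (f : Fin n → ℕ) v → Fin (f v) → Fin (sumℕ f)
inject f zero    x = x ↑ˡ sumℕ (f ∘ suc)
inject f (suc v) x = f zero ↑ʳ inject (f ∘ suc) v x

project : ∀ {n} (f : Fin n → ℕ) → Fin (sumℕ f) → ∃ (Fin ∘ f)
project {suc n} f x with splitAt (f zero) x
... | inj₁ y = zero , y
... | inj₂ y = let v , z = project (f ∘ suc) y in suc v , z

project-inject : ∀ {n} (f : Fin n → ℕ) v x → project f (inject f v x) ≡ (v , x)
project-inject f zero x rewrite Fin.splitAt-↑ˡ (f zero) x (sumℕ (f ∘ suc)) = ≡.refl
project-inject f (suc v) x rewrite Fin.splitAt-↑ʳ (f zero) (sumℕ (f ∘ suc)) (inject (f ∘ suc) v x)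
  | project-inject (f ∘ suc) v x = ≡.refl

inject-project : ∀ {n} (f : Fin n → ℕ) x → let v , y = project f x in inject f v y ≡ x
inject-project {suc n} f x with splitAt (f zero) x in eq
... | inj₁ y = Fin.splitAt⁻¹-↑ˡ eq
... | inj₂ y = ≡.trans (≡.cong (f zero ↑ʳ_) (inject-project (f ∘ suc) y)) (Fin.splitAt⁻¹-↑ʳ eq)

module _ {P : Set} {m : ℕ} where
  -- Serves the conditional summands of `walksVia`: an index into such a summand carries the
  -- evidence that the arc is present.
  guard : (P? : Dec P) → P → Fin m → Fin (if does P? then m else 0)
  guard (yes _) p x = x
  guard (no ¬p) p x = ⊥-elim (¬p p)

  unguard : (P? : Dec P) → Fin (if does P? then m else 0) → P × Fin m
  unguard (yes p) x = p , x

  unguard-guard : ∀ P? p x → proj₂ (unguard P? (guard P? p x)) ≡ x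
  unguard-guard (yes _) p x = ≡.refl
  unguard-guard (no ¬p) p x = ⊥-elim (¬p p)

  unguard-injective : ∀ P? {x y} → proj₂ (unguard P? x) ≡ proj₂ (unguard P? y) → x ≡ y
  unguard-injective (yes _) eq = eq

update : (ℕ → ℕ) → ℕ → ℕ → ℕ → ℕ
update c q a x = if does (x ℕ.≟ q) then a else c x

update-same : ∀ c q a → update c q a q ≡ a
update-same c q a = ≡.cong (if_then a else c q) (dec-true (q ℕ.≟ q) ≡.refl)

update-other : ∀ c {q} a {x} → x ≢ q → update c q a x ≡ c x
update-other c {q} a {x} x≢q = ≡.cong (if_then a else c x) (dec-false (x ℕ.≟ q) x≢q)

update-≤ : ∀ c q a {M} x → a ℕ.≤ M → c x ℕ.≤ M → update c q a x ℕ.≤ M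
update-≤ c q a x a≤M cx≤M with does (x ℕ.≟ q)
... | true  = a≤M
... | false = cx≤M

-- Arcs, walks and codes of walks.

module Digraph {k s : ℕ} (s<k : s ℕ.< k) where

  arc-low : ∀ {u v} → toℕ u ℕ.< s → Arc k s u v
  arc-low u<s (i , _ , u≡s+i , _) = ℕ.<⇒≱ u<s (≡.subst (s ℕ.≤_) (≡.sym u≡s+i) (ℕ.m≤m+n s (toℕ i)))

  arc-high : ∀ {u v} → k ∸ s ℕ.≤ toℕ v → Arc k s u v
  arc-high k-s≤v (_ , j , _ , v≡j , _) = ℕ.<⇒≱ (Fin.toℕ<n j) (≡.subst (k ∸ s ℕ.≤_) v≡j k-s≤v)

  arc-shift : ∀ {u v} → toℕ u ≡ s ℕ.+ toℕ v → Arc k s u v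
  arc-shift u≡s+v (i , j , u≡s+i , v≡j , i≢j) = i≢j (Fin.toℕ-injective
    (ℕ.+-cancelˡ-≡ s (toℕ i) (toℕ j) (≡.trans (≡.sym u≡s+i) (≡.trans u≡s+v (≡.cong (s ℕ.+_) v≡j)))))

  -- In terms of positions in two consecutive windows: the first point lies before the overlap, the
  -- second lies beyond it, or the two points coincide.
  arc-cases : ∀ {u v} → Arc k s u v → toℕ u ℕ.< s ⊎ (k ∸ s ℕ.≤ toℕ v ⊎ toℕ u ≡ s ℕ.+ toℕ v)
  arc-cases {u} {v} arc with toℕ u ℕ.<? s | k ∸ s ℕ.≤? toℕ v
  ... | yes u<s | _ = inj₁ u<s
  ... | no _ | yes k-s≤v = inj₂ (inj₁ k-s≤v)
  ... | no u≮s | no k-s≰v with toℕ u ∸ s ℕ.≟ toℕ v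
  ...   | yes eq = inj₂ (inj₂ (≡.trans (≡.sym (ℕ.m+[n∸m]≡n (ℕ.≮⇒≥ u≮s))) (≡.cong (s ℕ.+_) eq)))
  ...   | no neq = ⊥-elim (arc (fromℕ< i<k-s , fromℕ< v<k-s ,
      ≡.trans (≡.sym (ℕ.m+[n∸m]≡n (ℕ.≮⇒≥ u≮s))) (≡.cong (s ℕ.+_) (≡.sym (Fin.toℕ-fromℕ< i<k-s))) ,
      ≡.sym (Fin.toℕ-fromℕ< v<k-s) ,
      λ eq → neq (≡.trans (≡.sym (Fin.toℕ-fromℕ< i<k-s)) (≡.trans (≡.cong toℕ eq) (Fin.toℕ-fromℕ< v<k-s)))))
    where
    i<k-s = ℕ.∸-monoˡ-< (Fin.toℕ<n u) (ℕ.≮⇒≥ u≮s)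
    v<k-s = ℕ.≰⇒> k-s≰v

  mutual
    walks : ℕ → Fin k → ℕ
    walks zero    u = 1
    walks (suc n) u = sumℕ (walksVia n u)

    walksVia : ℕ → Fin k → Fin k → ℕ
    walksVia n u v = if does (arc? k s u v) then walks n v else 0

  IsWalk : (ℕ → Fin k) → Set
  IsWalk u = ∀ i → Arc k s (u i) (u (suc i))

  -- Walks are infinite sequences, of which a code records the first `n` entries, that is, the `n`
  -- vertices visited after the start `a`.
  encode : ∀ n {a} u → Arc k s a (u 0) → IsWalk u → Fin (walks n a)
  encode zero    u a⟶u₀ walk = zero
  encode (suc n) {a} u a⟶u₀ walk = inject (walksVia n a) (u 0)
    (guard (arc? k s a (u 0)) a⟶u₀ (encode n (u ∘ suc) (walk 0) (walk ∘ suc)))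

  module _ (0<s : 0 ℕ.< s) where
    -- Receives an arc from every vertex, itself included, so it can continue any decoded walk
    -- forever.
    lastVertex : Fin k
    lastVertex = fromℕ< (ℕ.∸-monoʳ-< {k} (ℕ.s≤s ℕ.z≤n) (ℕ.<-≤-trans 0<s (ℕ.<⇒≤ s<k)))

    arc-last : ∀ {u} → Arc k s u lastVertex
    arc-last = arc-high (≡.subst (k ∸ s ℕ.≤_) (≡.sym (Fin.toℕ-fromℕ< _)) (ℕ.∸-monoʳ-≤ k 0<s))

    mutual
      decode : ∀ n a → Fin (walks n a) → ℕ → Fin k
      decode zero    a z i = lastVertex
      decode (suc n) a z   = decodeStep n a (project (walksVia n a) z)

      decodeStep : ∀ n a → ∃ (Fin ∘ walksVia n a) → ℕ → Fin k
      decodeStep n a (v , x) zero    = v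
      decodeStep n a (v , x) (suc i) = decode n v (proj₂ (unguard (arc? k s a v) x)) i

    decode-start : ∀ n a z → Arc k s a (decode n a z 0)
    decode-start zero    a z = arc-last
    decode-start (suc n) a z = let v , x = project (walksVia n a) z in proj₁ (unguard (arc? k s a v) x)

    decode-isWalk : ∀ n a z → IsWalk (decode n a z)
    decode-isWalk zero    a z i       = arc-last
    decode-isWalk (suc n) a z zero    = decode-start n _ _
    decode-isWalk (suc n) a z (suc i) = decode-isWalk n _ _ i

    decode-encode : ∀ n {a} u (a⟶u₀ : Arc k s a (u 0)) (walk : IsWalk u) → ∀ i → i ℕ.< n →
      decode n a (encode n u a⟶u₀ walk) i ≡ u i
    decode-encode (suc n) {a} u a⟶u₀ walk i i<n
      rewrite project-inject (walksVia n a) (u 0)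
        (guard (arc? k s a (u 0)) a⟶u₀ (encode n (u ∘ suc) (walk 0) (walk ∘ suc))) = step i i<n
      where
      step : ∀ i → i ℕ.< suc n → decodeStep n a (u 0 , guard (arc? k s a (u 0)) a⟶u₀ (encode n (u ∘ suc) (walk 0) (walk ∘ suc))) i ≡ u i
      step zero    _ = ≡.refl
      step (suc i) (ℕ.s≤s i<n) = ≡.trans
        (≡.cong (λ z → decode n (u 0) z i) (unguard-guard (arc? k s a (u 0)) a⟶u₀ _))
        (decode-encode n (u ∘ suc) (walk 0) (walk ∘ suc) i i<n)

    encode-injective : ∀ n {a} (u u′ : ℕ → Fin k) {a⟶u₀ walk a⟶u₀′ walk′} →
      encode n {a} u a⟶u₀ walk ≡ encode n u′ a⟶u₀′ walk′ → ∀ i → i ℕ.< n → u i ≡ u′ i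
    encode-injective n {a} u u′ eq i i<n = ≡.trans (≡.sym (decode-encode n u _ _ i i<n))
      (≡.trans (≡.cong (λ z → decode n a z i) eq) (decode-encode n u′ _ _ i i<n))

    mutual
      decode-injective : ∀ n {a} {z z′ : Fin (walks n a)} →
        (∀ i → i ℕ.< n → decode n a z i ≡ decode n a z′ i) → z ≡ z′
      decode-injective zero {z = zero} {z′ = zero} _ = ≡.refl
      decode-injective (suc n) {a} {z} {z′} eq = ≡.trans (≡.sym (inject-project (walksVia n a) z))
        (≡.trans (≡.cong (λ (v , x) → inject (walksVia n a) v x) (decodeStep-injective n eq)) (inject-project (walksVia n a) z′))

      decodeStep-injective : ∀ n {a vx vx′} →
        (∀ i → i ℕ.< suc n → decodeStep n a vx i ≡ decodeStep n a vx′ i) → vx ≡ vx′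
      decodeStep-injective n {a} {v , x} {v′ , x′} eq with eq 0 (ℕ.s≤s ℕ.z≤n)
      ... | ≡.refl = ≡.cong (v ,_) (unguard-injective (arc? k s a v)
        (decode-injective n λ i i<n → eq (suc i) (ℕ.s≤s i<n)))

  -- Weights that peak exactly along a given walk.

  window-mono : ∀ {i m} → i ℕ.≤ m → s ℕ.* i ℕ.+ k ℕ.≤ s ℕ.* m ℕ.+ k
  window-mono i≤m = ℕ.+-monoˡ-≤ k (ℕ.*-monoʳ-≤ s i≤m)

  shift≡ : ∀ m r → s ℕ.* suc m ℕ.+ r ≡ s ℕ.* m ℕ.+ (s ℕ.+ r)
  shift≡ m r = ≡.trans (≡.cong (ℕ._+ r) (≡.trans (ℕ.*-suc s m) (ℕ.+-comm s (s ℕ.* m)))) (ℕ.+-assoc (s ℕ.* m) s r)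

  window-end≡ : ∀ m → s ℕ.* suc m ℕ.+ (k ∸ s) ≡ s ℕ.* m ℕ.+ k
  window-end≡ m = ≡.trans (shift≡ m (k ∸ s)) (≡.cong (s ℕ.* m ℕ.+_) (ℕ.m+[n∸m]≡n (ℕ.<⇒≤ s<k)))

  module _ (u : ℕ → Fin k) (walk : IsWalk u) where

    position : ℕ → ℕ
    position i = s ℕ.* i ℕ.+ toℕ (u i)

    position<window-end : ∀ i → position i ℕ.< s ℕ.* i ℕ.+ k
    position<window-end i = ℕ.+-monoʳ-< (s ℕ.* i) (Fin.toℕ<n (u i))

    low⇒position< : ∀ m → toℕ (u m) ℕ.< s → position m ℕ.< s ℕ.* suc m
    low⇒position< m um<s = ≡.subst (position m ℕ.<_) (≡.trans (ℕ.+-comm (s ℕ.* m) s) (≡.sym (ℕ.*-suc s m))) (ℕ.+-monoʳ-< (s ℕ.* m) um<s)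

    high⇒window-end≤ : ∀ m → k ∸ s ℕ.≤ toℕ (u (suc m)) → s ℕ.* m ℕ.+ k ℕ.≤ position (suc m)
    high⇒window-end≤ m high = ≡.subst (ℕ._≤ position (suc m)) (window-end≡ m) (ℕ.+-monoʳ-≤ (s ℕ.* suc m) high)

    shift⇒position≡ : ∀ m → toℕ (u m) ≡ s ℕ.+ toℕ (u (suc m)) → position m ≡ position (suc m)
    shift⇒position≡ m eq = ≡.trans (≡.cong (s ℕ.* m ℕ.+_) eq) (≡.sym (shift≡ m _))

    -- Prepares the low case: if the point of window `m` lies before window `m + 1`, so do all
    -- earlier points. A low arc leaves a point to the left of every later window, a high arc moves
    -- to the right, and a shift keeps the point.
    position-bound : ∀ m i → i ℕ.≤ m → position i ℕ.< s ℕ.* suc m ⊎ position i ℕ.≤ position m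
    position-bound m i i≤m with ℕ.m≤n⇒m<n∨m≡n i≤m
    ... | inj₂ ≡.refl = inj₂ ℕ.≤-refl
    position-bound (suc m) i _ | inj₁ (ℕ.s≤s i≤m) with position-bound m i i≤m
    ... | inj₁ p< = inj₁ (ℕ.<-≤-trans p< (ℕ.*-monoʳ-≤ s (ℕ.n≤1+n (suc m))))
    ... | inj₂ p≤ with arc-cases (walk m)
    ...   | inj₁ low = inj₁ (ℕ.≤-<-trans p≤ (ℕ.<-≤-trans (low⇒position< m low) (ℕ.*-monoʳ-≤ s (ℕ.n≤1+n (suc m)))))
    ...   | inj₂ (inj₁ high) = inj₂ (ℕ.≤-trans p≤ (ℕ.≤-trans (ℕ.<⇒≤ (position<window-end m)) (high⇒window-end≤ m high)))
    ...   | inj₂ (inj₂ shift) = inj₂ (ℕ.≤-trans p≤ (ℕ.≤-reflexive (shift⇒position≡ m shift)))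

    PeaksAt : (ℕ → ℕ) → ℕ → Set
    PeaksAt c i = ∀ r → r ℕ.< k → r ≢ toℕ (u i) → c (s ℕ.* i ℕ.+ r) ℕ.< c (position i)

    -- The induction carries two extra data: `max` leaves room for a higher peak in the next window,
    -- and `fresh` keeps everything beyond window `m` at 0, so that a shift can reuse the weights
    -- unchanged.
    record Weights (m : ℕ) : Set where
      field
        weight : ℕ → ℕ
        max    : ℕ
        ≤max   : ∀ x → weight x ℕ.≤ max
        fresh  : ∀ x → s ℕ.* m ℕ.+ k ℕ.≤ x → weight x ≡ 0
        peaks  : ∀ i → i ℕ.≤ m → PeaksAt weight i

    weights-zero : Weights 0
    weights-zero = record
      { weight = update (λ _ → 0) (position 0) 1
      ; max    = 1
      ; ≤max   = λ x → update-≤ (λ _ → 0) (position 0) 1 x ℕ.≤-refl ℕ.z≤n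
      ; fresh  = λ x end≤x → update-other (λ _ → 0) 1 (ℕ.>⇒≢ (ℕ.<-≤-trans (position<window-end 0) end≤x))
      ; peaks  = λ where
          zero _ r _ r≢u → ≡.subst₂ ℕ._<_
            (≡.sym (update-other (λ _ → 0) 1 (λ eq → r≢u (ℕ.+-cancelˡ-≡ (s ℕ.* 0) _ _ eq))))
            (≡.sym (update-same (λ _ → 0) (position 0) 1)) (ℕ.s≤s ℕ.z≤n)
      }

    -- The new peak lies outside all earlier windows, so it can be made the largest.
    weights-high : ∀ m → s ℕ.* m ℕ.+ k ℕ.≤ position (suc m) → Weights m → Weights (suc m)
    weights-high m end≤q w = record
      { weight = c′
      ; max    = suc max
      ; ≤max   = λ x → update-≤ weight q (suc max) x ℕ.≤-refl (ℕ.m≤n⇒m≤1+n (≤max x))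
      ; fresh  = λ x end≤x → ≡.trans
          (update-other weight (suc max) (ℕ.>⇒≢ (ℕ.<-≤-trans (position<window-end (suc m)) end≤x)))
          (fresh x (ℕ.≤-trans (window-mono (ℕ.n≤1+n m)) end≤x))
      ; peaks  = peaks′
      }
      where
      open Weights w
      q = position (suc m)
      c′ = update weight q (suc max)
      old : ∀ {i r} → i ℕ.≤ m → r ℕ.< k → c′ (s ℕ.* i ℕ.+ r) ≡ weight (s ℕ.* i ℕ.+ r)
      old {i} i≤m r<k = update-other weight (suc max)
        (ℕ.<⇒≢ (ℕ.<-≤-trans (ℕ.+-monoʳ-< (s ℕ.* i) r<k) (ℕ.≤-trans (window-mono i≤m) end≤q)))
      peaks′ : ∀ i → i ℕ.≤ suc m → PeaksAt c′ i
      peaks′ i i≤1+m r r<k r≢u with ℕ.m≤n⇒m<n∨m≡n i≤1+m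
      ... | inj₁ (ℕ.s≤s i≤m) = ≡.subst₂ ℕ._<_ (≡.sym (old i≤m r<k)) (≡.sym (old i≤m (Fin.toℕ<n (u i)))) (peaks i i≤m r r<k r≢u)
      ... | inj₂ ≡.refl = ≡.subst₂ ℕ._<_
        (≡.sym (update-other weight (suc max) (λ eq → r≢u (ℕ.+-cancelˡ-≡ (s ℕ.* suc m) _ _ eq))))
        (≡.sym (update-same weight q (suc max))) (ℕ.s≤s (≤max _))

    -- The common point already peaks in window `m`, and the points that window `m + 1` adds have
    -- weight 0. What remains is that the peak is positive.
    weights-shift : ∀ m → toℕ (u m) ≡ s ℕ.+ toℕ (u (suc m)) → 0 ℕ.< s → Weights m → Weights (suc m)
    weights-shift m shift 0<s w = record
      { weight = weight
      ; max    = max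
      ; ≤max   = ≤max
      ; fresh  = λ x end≤x → fresh x (ℕ.≤-trans (window-mono (ℕ.n≤1+n m)) end≤x)
      ; peaks  = peaks′
      }
      where
      open Weights w
      -- A shift forces `u m ≥ s > 0`, so the left end of window `m` is not the peak and weighs
      -- strictly less.
      0<peak : 0 ℕ.< weight (position m)
      0<peak = ℕ.≤-<-trans ℕ.z≤n (peaks m ℕ.≤-refl 0 (ℕ.≤-<-trans ℕ.z≤n s<k)
        (ℕ.<⇒≢ (≡.subst (0 ℕ.<_) (≡.sym shift) (ℕ.<-≤-trans 0<s (ℕ.m≤m+n s _)))))
      peaks′ : ∀ i → i ℕ.≤ suc m → PeaksAt weight i
      peaks′ i i≤1+m r r<k r≢u with ℕ.m≤n⇒m<n∨m≡n i≤1+m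
      ... | inj₁ (ℕ.s≤s i≤m) = peaks i i≤m r r<k r≢u
      ... | inj₂ ≡.refl = ≡.subst₂ ℕ._<_ (≡.cong weight (≡.sym (shift≡ m r))) (≡.cong weight (shift⇒position≡ m shift)) below
        where
        below : weight (s ℕ.* m ℕ.+ (s ℕ.+ r)) ℕ.< weight (position m)
        below with s ℕ.+ r ℕ.<? k
        ... | yes s+r<k = peaks m ℕ.≤-refl (s ℕ.+ r) s+r<k (λ eq → r≢u (ℕ.+-cancelˡ-≡ s r _ (≡.trans eq shift)))
        ... | no s+r≮k  = ≡.subst (ℕ._< weight (position m))
          (≡.sym (fresh _ (ℕ.+-monoʳ-≤ (s ℕ.* m) (ℕ.≮⇒≥ s+r≮k)))) 0<peak

    -- All earlier peaks lie to the left of the new window, so the new window can be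
    -- pushed below everything else.
    weights-low : ∀ m → toℕ (u m) ℕ.< s → Weights m → Weights (suc m)
    weights-low m low w = record
      { weight = c′
      ; max    = 2 ℕ.+ max
      ; ≤max   = ≤max′
      ; fresh  = λ x end≤x → ≡.trans (right (ℕ.≤-trans (ℕ.m≤m+n _ k) end≤x))
          (update-other (λ _ → 0) 1 (ℕ.>⇒≢ (ℕ.<-≤-trans (position<window-end (suc m)) end≤x)))
      ; peaks  = peaks′
      }
      where
      open Weights w
      b = s ℕ.* suc m
      q = position (suc m)
      c₁ c′ : ℕ → ℕ
      c₁ = update (λ _ → 0) q 1
      c′ x = if does (x ℕ.<? b) then 2 ℕ.+ weight x else c₁ x
      c₁≤1 : ∀ x → c₁ x ℕ.≤ 1
      c₁≤1 x = update-≤ (λ _ → 0) q 1 x ℕ.≤-refl ℕ.z≤n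
      left : ∀ {x} → x ℕ.< b → c′ x ≡ 2 ℕ.+ weight x
      left {x} x<b = ≡.cong (if_then 2 ℕ.+ weight x else c₁ x) (dec-true (x ℕ.<? b) x<b)
      right : ∀ {x} → b ℕ.≤ x → c′ x ≡ c₁ x
      right {x} b≤x = ≡.cong (if_then 2 ℕ.+ weight x else c₁ x) (dec-false (x ℕ.<? b) (ℕ.≤⇒≯ b≤x))
      ≤max′ : ∀ x → c′ x ℕ.≤ 2 ℕ.+ max
      ≤max′ x with ℕ.<-≤-connex x b
      ... | inj₁ x<b = ≡.subst (ℕ._≤ 2 ℕ.+ max) (≡.sym (left x<b)) (ℕ.s≤s (ℕ.s≤s (≤max x)))
      ... | inj₂ b≤x = ≡.subst (ℕ._≤ 2 ℕ.+ max) (≡.sym (right b≤x)) (ℕ.≤-trans (c₁≤1 x) (ℕ.s≤s ℕ.z≤n))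
      position<b : ∀ i → i ℕ.≤ m → position i ℕ.< b
      position<b i i≤m with position-bound m i i≤m
      ... | inj₁ p< = p<
      ... | inj₂ p≤ = ℕ.≤-<-trans p≤ (low⇒position< m low)
      peaks′ : ∀ i → i ℕ.≤ suc m → PeaksAt c′ i
      peaks′ i i≤1+m r r<k r≢u with ℕ.m≤n⇒m<n∨m≡n i≤1+m
      ... | inj₂ ≡.refl = ≡.subst₂ ℕ._<_
        (≡.sym (≡.trans (right (ℕ.m≤m+n b r)) (update-other (λ _ → 0) 1 (λ eq → r≢u (ℕ.+-cancelˡ-≡ b _ _ eq)))))
        (≡.sym (≡.trans (right (ℕ.m≤m+n b _)) (update-same (λ _ → 0) q 1))) (ℕ.s≤s ℕ.z≤n)
      ... | inj₁ (ℕ.s≤s i≤m) = ≡.subst (c′ (s ℕ.* i ℕ.+ r) ℕ.<_) (≡.sym (left (position<b i i≤m))) below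
        where
        below : c′ (s ℕ.* i ℕ.+ r) ℕ.< 2 ℕ.+ weight (position i)
        below with ℕ.<-≤-connex (s ℕ.* i ℕ.+ r) b
        ... | inj₁ x<b = ≡.subst (ℕ._< 2 ℕ.+ weight (position i)) (≡.sym (left x<b)) (ℕ.s≤s (ℕ.s≤s (peaks i i≤m r r<k r≢u)))
        ... | inj₂ b≤x = ≡.subst (ℕ._< 2 ℕ.+ weight (position i)) (≡.sym (right b≤x)) (ℕ.s≤s (ℕ.≤-trans (c₁≤1 (s ℕ.* i ℕ.+ r)) (ℕ.s≤s ℕ.z≤n)))

    weights : 0 ℕ.< s → ∀ m → Weights m
    weights 0<s zero    = weights-zero
    weights 0<s (suc m) with arc-cases (walk m)
    ... | inj₁ low          = weights-low m low (weights 0<s m)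
    ... | inj₂ (inj₁ high)  = weights-high m (high⇒window-end≤ m high) (weights 0<s m)
    ... | inj₂ (inj₂ shift) = weights-shift m shift 0<s (weights 0<s m)

-- Linear functionals on simplices.

module Functionals (R : RealNumbers) where
  open Summation R public
  open import Relation.Binary.Reasoning.Setoid setoid

  sum-single : ∀ {n} {f : Fin n → Carrier} j → (∀ i → i ≢ j → f i ≈ 0#) → sum f ≈ f j
  sum-single {suc n} zero p = trans (+-congˡ (trans (sum-cong-≋ {n} λ i → p (suc i) λ ()) (sum-replicate-zero n))) (+-identityʳ _)
  sum-single {suc n} (suc j) p = trans (+-cong (p zero λ ()) (sum-single j λ i i≢j → p (suc i) (i≢j ∘ Fin.suc-injective))) (+-identityˡ _)

  sum-≈0 : ∀ {n} {f : Fin n → Carrier} → (∀ i → 0# ≤ f i) → sum f ≈ 0# → ∀ i → f i ≈ 0#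
  sum-≈0 {suc n} {f} 0≤f eq zero = ≤-antisym
    (≤-respʳ eq (≤-intro (0≤sum (0≤f ∘ suc)) refl)) (0≤f zero)
  sum-≈0 {suc n} {f} 0≤f eq (suc i) = sum-≈0 (0≤f ∘ suc) (≤-antisym
    (≤-respʳ eq (≤-intro (0≤f zero) (+-comm _ _))) (0≤sum (0≤f ∘ suc))) i

  sum-difference : ∀ {n} (f g : Fin n → Carrier) → sum (λ i → f i - g i) ≈ sum f - sum g
  sum-difference f g = begin
    sum (λ i → f i - g i)                     ≈⟨ solve 2 (λ a b → a := (a :+ b) :- b) refl (sum λ i → f i - g i) (sum g) ⟩
    (sum (λ i → f i - g i) + sum g) - sum g   ≈⟨ +-congʳ (∑-distrib-+ (λ i → f i - g i) g) ⟨
    sum (λ i → f i - g i + g i) - sum g       ≈⟨ +-congʳ (sum-cong-≋ λ i → solve 2 (λ a b → a :- b :+ b := a) refl (f i) (g i)) ⟩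
    sum f - sum g                             ∎

  sum-≤-tight : ∀ {n} {f g : Fin n → Carrier} → (∀ i → f i ≤ g i) → sum f ≈ sum g → ∀ i → f i ≈ g i
  sum-≤-tight {f = f} {g} f≤g eq i = trans
    (solve 2 (λ a b → a := b :- (b :- a)) refl (f i) (g i))
    (trans (+-congˡ (-‿cong (sum-≈0 (λ i → ≤-difference (f≤g i))
      (trans (sum-difference g f) (trans (+-congˡ (-‿cong eq)) (-‿inverseʳ _))) i)))
      (solve 1 (λ b → b :- con (+ 0) := b) refl (g i)))

  basis-same : ∀ {d} (j : Fin d) → basis j j ≡ 1#
  basis-same j = ≡.cong (if_then 1# else 0#) (dec-true (j Fin.≟ j) ≡.refl)

  basis-other : ∀ {d} {i j : Fin d} → i ≢ j → basis j i ≡ 0#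
  basis-other {i = i} {j} i≢j = ≡.cong (if_then 1# else 0#) (dec-false (i Fin.≟ j) i≢j)

  ∙-basis : ∀ {d} (c : Point d) j → c ∙ basis j ≈ c j
  ∙-basis c j = trans (sum-single j λ i i≢j → trans (*-congˡ (reflexive (basis-other i≢j))) (zeroʳ _))
    (trans (*-congˡ (reflexive (basis-same j))) (*-identityʳ _))

  ∙-cong : ∀ {d} (c : Point d) {x y} → x ≋ y → c ∙ x ≈ c ∙ y
  ∙-cong c x≋y = sum-cong-≋ λ j → *-congˡ (x≋y j)

  ∙-sum : ∀ {d n} (c : Point d) (y : Fin n → Point d) → c ∙ (λ j → sum λ i → y i j) ≈ sum λ i → c ∙ y i
  ∙-sum c y = trans (sum-cong-≋ λ j → *-distribˡ-sum (c j) (λ i → y i j)) (∑-comm λ j i → c j * y i j)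

  ∙-scale : ∀ {d} (c : Point d) w x → c ∙ (λ j → w * x j) ≈ w * (c ∙ x)
  ∙-scale c w x = trans (sum-cong-≋ λ j → solve 3 (λ c w x → c :* (w :* x) := w :* (c :* x)) refl (c j) w (x j))
    (sym (*-distribˡ-sum w λ j → c j * x j))

  basis∈simplex : ∀ {d} {W : Pred (Fin d) 0ℓ} {j} → j ∈ W → basis j ∈ simplex W
  basis∈simplex {j = j} j∈W = 1 , (λ _ → basis j) , (λ _ → 1#) ,
    (λ _ → j , j∈W , λ _ → refl) , (λ _ → <⇒≤ 0<1) , +-identityʳ 1# ,
    λ i → sym (trans (+-identityʳ _) (*-identityˡ _))

  module _ {d} {W : Pred (Fin d) 0ℓ} (c : Point d) {M} (c≤M : ∀ j → j ∈ W → c j ≤ M) where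

    private
      M-weighted : ∀ {m} (w : Fin m → Carrier) → sum w ≈ 1# → sum (λ l → w l * M) ≈ M
      M-weighted w Σw≈1 = trans (sym (*-distribʳ-sum M w)) (trans (*-congʳ Σw≈1) (*-identityˡ M))

      ∙-conv : ∀ {y m} {p : Fin m → Point d} {w : Fin m → Carrier} → y ≋ (λ j → sum λ l → w l * p l j) →
        (v : ∀ l → ∃[ j ] (j ∈ W × p l ≋ basis j)) → c ∙ y ≈ sum λ l → w l * c (proj₁ (v l))
      ∙-conv {p = p} {w} y≋ v = trans (∙-cong c y≋) (trans (∙-sum c λ l j → w l * p l j)
        (sum-cong-≋ λ l → trans (∙-scale c (w l) (p l))
          (*-congˡ (trans (∙-cong c (proj₂ (proj₂ (v l)))) (∙-basis c _)))))

    ∙-simplex-≤ : ∀ {y} → y ∈ simplex W → c ∙ y ≤ M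
    ∙-simplex-≤ {y} (m , p , w , v , 0≤w , Σw≈1 , y≋) = ≤-respˡ (sym (∙-conv {y} y≋ v)) (≤-respʳ (M-weighted w Σw≈1)
      (sum-mono-≤ λ l → *-monoˡ-≤ (0≤w l) (c≤M _ (proj₁ (proj₂ (v l))))))

    -- Equality forces `w l * (M - c j) ≈ 0#` for every generator `basis j`, so generators other
    -- than `basis j₀` have weight 0. A basis vector may occur several times, hence the comparison
    -- runs over generators and not over coordinates.
    ∙-simplex-≈ : ∀ {j₀ y} → (∀ j → j ∈ W → j ≢ j₀ → c j < M) → y ∈ simplex W → c ∙ y ≈ M → y ≋ basis j₀
    ∙-simplex-≈ {j₀} {y} c<M (m , p , w , v , 0≤w , Σw≈1 , y≋) cy≈M j = trans (y≋ j)
      (trans (sum-cong-≋ at-j₀)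
        (trans (sym (*-distribʳ-sum (basis j₀ j) w)) (trans (*-congʳ Σw≈1) (*-identityˡ _))))
      where
      tight : ∀ l → w l * c (proj₁ (v l)) ≈ w l * M
      tight = sum-≤-tight (λ l → *-monoˡ-≤ (0≤w l) (c≤M _ (proj₁ (proj₂ (v l)))))
        (trans (sym (∙-conv {y} y≋ v)) (trans cy≈M (sym (M-weighted w Σw≈1))))
      at-j₀ : ∀ l → w l * p l j ≈ w l * basis j₀ j
      at-j₀ l with proj₁ (v l) Fin.≟ j₀
      ... | yes eq = *-congˡ (trans (proj₂ (proj₂ (v l)) j) (reflexive (≡.cong (λ i → basis i j) eq)))
      ... | no neq = trans (trans (*-congʳ w≈0) (zeroˡ _)) (sym (trans (*-congʳ w≈0) (zeroˡ _)))
        where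
        w≈0 : w l ≈ 0#
        w≈0 = *-cancel-≈0 (<-difference (c<M _ (proj₁ (proj₂ (v l))) neq))
          (trans (solve 3 (λ w a b → (b :- a) :* w := w :* b :- w :* a) refl (w l) (c (proj₁ (v l))) M)
            (trans (+-congˡ (-‿cong (tight l))) (-‿inverseʳ _)))

  -- Breaking ties to the left makes overlapping windows compatible: when the maxima of two
  -- consecutive windows both lie in the overlap, each is the leftmost maximum there.
  leftmost-max : ∀ {n} → 0 ℕ.< n → (g : Fin n → Carrier) →
    ∃[ a ] ((∀ i → g i ≤ g a) × (∀ i → toℕ i ℕ.< toℕ a → g i < g a))
  leftmost-max {suc zero} _ g = zero , (λ { zero → ≤-refl }) , λ _ ()
  leftmost-max {suc (suc n)} _ g with leftmost-max {suc n} (ℕ.s≤s ℕ.z≤n) (g ∘ suc)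
  ... | a , g≤ , g< with <⊎≥ (g zero) (g (suc a))
  ...   | inj₁ g₀< = suc a , (λ { zero → <⇒≤ g₀< ; (suc i) → g≤ i }) ,
            λ { zero _ → g₀< ; (suc i) (ℕ.s≤s i<a) → g< i i<a }
  ...   | inj₂ ≤g₀ = zero , (λ { zero → ≤-refl ; (suc i) → ≤-trans (g≤ i) ≤g₀ }) , λ _ ()

-- Vertices of the polytope as walks from the origin.

module VertexCount (R : RealNumbers) {k s : ℕ} (0<s : 0 ℕ.< s) (s<k : s ℕ.< k) where
  open Functionals R
  open Digraph {k} {s} s<k

  0<k : 0 ℕ.< k
  0<k = ℕ.<-trans 0<s s<k

  origin : Fin k
  origin = fromℕ< 0<k

  arc-origin : ∀ {v} → Arc k s origin v
  arc-origin = arc-low (≡.subst (ℕ._< s) (≡.sym (Fin.toℕ-fromℕ< 0<k)) 0<s)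

  module _ (g : ℕ → Carrier) where

    peak : ℕ → Fin k
    peak i = proj₁ (leftmost-max 0<k (λ r → g (s ℕ.* i ℕ.+ toℕ r)))

    peak-max : ∀ i r → g (s ℕ.* i ℕ.+ toℕ r) ≤ g (s ℕ.* i ℕ.+ toℕ (peak i))
    peak-max i = proj₁ (proj₂ (leftmost-max 0<k (λ r → g (s ℕ.* i ℕ.+ toℕ r))))

    peak-max′ : ∀ i {r} → r ℕ.< k → g (s ℕ.* i ℕ.+ r) ≤ g (s ℕ.* i ℕ.+ toℕ (peak i))
    peak-max′ i {r} r<k = ≡.subst (λ l → g (s ℕ.* i ℕ.+ l) ≤ _) (Fin.toℕ-fromℕ< r<k) (peak-max i (fromℕ< r<k))

    peak-leftmost : ∀ i {r} → r ℕ.< toℕ (peak i) → g (s ℕ.* i ℕ.+ r) < g (s ℕ.* i ℕ.+ toℕ (peak i))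
    peak-leftmost i {r} r<peak = ≡.subst (λ l → g (s ℕ.* i ℕ.+ l) < _) (Fin.toℕ-fromℕ< r<k)
      (proj₂ (proj₂ (leftmost-max 0<k (λ r → g (s ℕ.* i ℕ.+ toℕ r)))) (fromℕ< r<k)
        (≡.subst (ℕ._< toℕ (peak i)) (≡.sym (Fin.toℕ-fromℕ< r<k)) r<peak))
      where r<k = ℕ.<-trans r<peak (Fin.toℕ<n (peak i))

    -- If two consecutive peaks both lie in the overlap of their windows, then their
    -- values agree and both are the leftmost maximum there.
    peak-isWalk : IsWalk peak
    peak-isWalk i (i′ , j′ , here≡ , next≡ , i′≢j′) with ℕ.<-cmp (toℕ i′) (toℕ j′)
    ... | tri≈ _ eq _ = i′≢j′ (Fin.toℕ-injective eq)
    ... | tri< i′<j′ _ _ = ≤⇒≯ B≤A (≡.subst (λ b → g A < g b) next-position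
        (peak-leftmost (suc i) (≡.subst (toℕ i′ ℕ.<_) (≡.sym next≡) i′<j′)))
      where
      A = s ℕ.* suc i ℕ.+ toℕ i′
      B = s ℕ.* suc i ℕ.+ toℕ j′
      next-position : s ℕ.* suc i ℕ.+ toℕ (peak (suc i)) ≡ B
      next-position = ≡.cong (s ℕ.* suc i ℕ.+_) next≡
      B≤A : g B ≤ g A
      B≤A = ≡.subst₂ (λ b a → g b ≤ g a) (≡.sym (shift≡ i (toℕ j′)))
        (≡.trans (≡.cong (s ℕ.* i ℕ.+_) here≡) (≡.sym (shift≡ i (toℕ i′)))) (peak-max′ i (≡.subst (s ℕ.+ toℕ j′ ℕ.<_) (ℕ.m+[n∸m]≡n (ℕ.<⇒≤ s<k)) (ℕ.+-monoʳ-< s (Fin.toℕ<n j′))))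
    ... | tri> _ _ j′<i′ = ≤⇒≯ A≤B (≡.subst₂ (λ b a → g b < g a) (≡.sym (shift≡ i (toℕ j′)))
        (≡.trans (≡.cong (s ℕ.* i ℕ.+_) here≡) (≡.sym (shift≡ i (toℕ i′))))
        (peak-leftmost i (≡.subst (s ℕ.+ toℕ j′ ℕ.<_) (≡.sym here≡) (ℕ.+-monoʳ-< s j′<i′))))
      where
      A = s ℕ.* suc i ℕ.+ toℕ i′
      B = s ℕ.* suc i ℕ.+ toℕ j′
      A≤B : g A ≤ g B
      A≤B = ≡.subst (λ b → g A ≤ g b) (≡.cong (s ℕ.* suc i ℕ.+_) next≡)
        (peak-max′ (suc i) (ℕ.<-≤-trans (Fin.toℕ<n i′) (ℕ.m∸n≤m k s)))

  module _ (m : ℕ) where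

    private
      n = suc m
      d = ambientDim n k s

    coordinate-< : (i : Fin n) (r : Fin k) → s ℕ.* toℕ i ℕ.+ toℕ r ℕ.< d
    coordinate-< i r = ℕ.<-≤-trans (ℕ.+-monoʳ-< (s ℕ.* toℕ i) (Fin.toℕ<n r)) (window-mono (Fin.toℕ≤pred[n] i))

    coordinate : Fin n → Fin k → Fin d
    coordinate i r = fromℕ< (coordinate-< i r)

    toℕ-coordinate : ∀ i r → toℕ (coordinate i r) ≡ s ℕ.* toℕ i ℕ.+ toℕ r
    toℕ-coordinate i r = Fin.toℕ-fromℕ< (coordinate-< i r)

    coordinate∈Window : ∀ i r → coordinate i r ∈ Window n k s i
    coordinate∈Window i r =
      ≡.subst (s ℕ.* toℕ i ℕ.≤_) (≡.sym (toℕ-coordinate i r)) (ℕ.m≤m+n _ _) ,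
      ≡.subst (ℕ._< s ℕ.* toℕ i ℕ.+ k) (≡.sym (toℕ-coordinate i r)) (ℕ.+-monoʳ-< (s ℕ.* toℕ i) (Fin.toℕ<n r))

    Window⇒coordinate : ∀ i j → j ∈ Window n k s i → ∃[ r ] j ≡ coordinate i r
    Window⇒coordinate i j (≤j , j<) = fromℕ< r<k , Fin.toℕ-injective (≡.sym (≡.trans (toℕ-coordinate i _)
      (≡.trans (≡.cong (s ℕ.* toℕ i ℕ.+_) (Fin.toℕ-fromℕ< r<k)) (ℕ.m+[n∸m]≡n ≤j))))
      where
      r<k : toℕ j ∸ s ℕ.* toℕ i ℕ.< k
      r<k = ≡.subst (toℕ j ∸ s ℕ.* toℕ i ℕ.<_) (ℕ.m+n∸m≡n (s ℕ.* toℕ i) k) (ℕ.∸-monoˡ-< j< ≤j)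

    choicePoint : (Fin n → Fin k) → Point d
    choicePoint r j = sum λ i → basis (coordinate i (r i)) j

    choicePoint∈polytope : ∀ r → choicePoint r ∈ polytope n k s
    choicePoint∈polytope r = (λ i → basis (coordinate i (r i))) , (λ i → basis∈simplex (coordinate∈Window i (r i))) , λ _ → refl

    ∙-choicePoint : ∀ (c : Point d) r → c ∙ choicePoint r ≈ sum λ i → c (coordinate i (r i))
    ∙-choicePoint c r = trans (∙-sum c λ i → basis (coordinate i (r i))) (sum-cong-≋ λ i → ∙-basis c (coordinate i (r i)))

    choicePoint-cong : ∀ {r r′} → (∀ i → r i ≡ r′ i) → choicePoint r ≋ choicePoint r′
    choicePoint-cong eq j = sum-cong-≋ λ i → reflexive (≡.cong (λ l → basis (coordinate i l) j) (eq i))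

    -- With the default 0 there is a peak for every window index, hence an infinite walk. Windows of
    -- index below `n` read only genuine coordinates.
    extend : Point d → ℕ → Carrier
    extend c x with x ℕ.<? d
    ... | yes x<d = c (fromℕ< x<d)
    ... | no _    = 0#

    extend-toℕ : ∀ c j → extend c (toℕ j) ≡ c j
    extend-toℕ c j with toℕ j ℕ.<? d
    ... | yes j<d = ≡.cong c (Fin.fromℕ<-toℕ j j<d)
    ... | no j≮d  = ⊥-elim (j≮d (Fin.toℕ<n j))

    -- The sum of window maxima maximises `c` over the polytope, so it belongs to the face that
    -- consists of `v` alone, whichever maxima were picked.
    vertex≋choicePoint : ∀ {v} → ((c , _) : IsVertex (polytope n k s) v) → v ≋ choicePoint (peak (extend c) ∘ toℕ)
    vertex≋choicePoint {v} (c , c₀ , valid , face) j = sym (Equivalence.to (face w) (choicePoint∈polytope r , w-tight) j)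
      where
      r = peak (extend c) ∘ toℕ
      w = choicePoint r
      c≤peak : ∀ i j → j ∈ Window n k s i → c j ≤ c (coordinate i (r i))
      c≤peak i j j∈W with Window⇒coordinate i j j∈W
      ... | r′ , ≡.refl = ≡.subst₂ _≤_ (value r′) (value (r i)) (peak-max (extend c) (toℕ i) r′)
        where
        value : ∀ l → extend c (s ℕ.* toℕ i ℕ.+ toℕ l) ≡ c (coordinate i l)
        value l = ≡.trans (≡.cong (extend c) (≡.sym (toℕ-coordinate i l))) (extend-toℕ c (coordinate i l))
      v-tight = Equivalence.from (face v) (λ _ → refl)
      c₀≤w : c₀ ≤ c ∙ w
      c₀≤w with v-tight
      ... | (y , y∈ , v≋) , cv≈c₀ = ≤-respˡ (trans (sym (trans (∙-cong c v≋) (∙-sum c y))) cv≈c₀)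
        (≤-respʳ (sym (∙-choicePoint c r)) (sum-mono-≤ λ i → ∙-simplex-≤ c (c≤peak i) (y∈ i)))
      w-tight : c ∙ w ≈ c₀
      w-tight = ≤-antisym (valid w (choicePoint∈polytope r)) c₀≤w

    module _ (u : ℕ → Fin k) (walk : IsWalk u) where
      open Weights (weights u walk 0<s m)

      functional : Point d
      functional j = fromℕ (weight (toℕ j))

      top : Fin n → Carrier
      top i = functional (coordinate i (u (toℕ i)))

      functional-< : ∀ i r → r ≢ u (toℕ i) → functional (coordinate i r) < top i
      functional-< i r r≢u = ≡.subst₂ (λ a b → fromℕ (weight a) < fromℕ (weight b))
        (≡.sym (toℕ-coordinate i r)) (≡.sym (toℕ-coordinate i (u (toℕ i))))
        (fromℕ-mono-< (peaks (toℕ i) (Fin.toℕ≤pred[n] i) (toℕ r) (Fin.toℕ<n r) (r≢u ∘ Fin.toℕ-injective)))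

      functional-≤ : ∀ i r → functional (coordinate i r) ≤ top i
      functional-≤ i r with r Fin.≟ u (toℕ i)
      ... | yes ≡.refl = ≤-refl
      ... | no r≢u     = <⇒≤ (functional-< i r r≢u)

      functional-window-≤ : ∀ i j → j ∈ Window n k s i → functional j ≤ top i
      functional-window-≤ i j j∈W with Window⇒coordinate i j j∈W
      ... | r , ≡.refl = functional-≤ i r

      functional-window-< : ∀ i j → j ∈ Window n k s i → j ≢ coordinate i (u (toℕ i)) → functional j < top i
      functional-window-< i j j∈W j≢ with Window⇒coordinate i j j∈W
      ... | r , ≡.refl = functional-< i r (λ eq → j≢ (≡.cong (coordinate i) eq))

      abstract
        walk-isVertex : IsVertex (polytope n k s) (choicePoint (u ∘ toℕ))
        walk-isVertex = functional , sum top , valid , λ x → mk⇔ (tight x) (attained x)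
          where
          valid : ∀ x → x ∈ polytope n k s → functional ∙ x ≤ sum top
          valid x (y , y∈ , x≋) = ≤-respˡ (sym (trans (∙-cong functional x≋) (∙-sum functional y)))
            (sum-mono-≤ λ i → ∙-simplex-≤ functional (functional-window-≤ i) (y∈ i))
          tight : ∀ x → x ∈ polytope n k s × functional ∙ x ≈ sum top → x ≋ choicePoint (u ∘ toℕ)
          tight x ((y , y∈ , x≋) , eq) j = trans (x≋ j) (sum-cong-≋ λ i →
            ∙-simplex-≈ functional (functional-window-≤ i) (functional-window-< i) (y∈ i)
              (sum-≤-tight (λ i → ∙-simplex-≤ functional (functional-window-≤ i) (y∈ i))
                (trans (sym (trans (∙-cong functional x≋) (∙-sum functional y))) eq) i) j)
          attained : ∀ x → x ≋ choicePoint (u ∘ toℕ) → x ∈ polytope n k s × functional ∙ x ≈ sum top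
          attained x x≋ = ((λ i → basis (coordinate i (u (toℕ i)))) , (λ i → basis∈simplex (coordinate∈Window i (u (toℕ i)))) , x≋) ,
            trans (∙-cong functional x≋) (∙-choicePoint functional (u ∘ toℕ))

      -- A sum of basis vectors forgets which window contributed which summand, so this fails for
      -- arbitrary choices. For a walk, its functional has a unique maximum in each window, and a
      -- choice with the same total value must attain all of them.
      choicePoint-injective : ∀ r → choicePoint (u ∘ toℕ) ≋ choicePoint r → ∀ i → u (toℕ i) ≡ r i
      choicePoint-injective r eq i with r i Fin.≟ u (toℕ i)
      ... | yes ri≡ = ≡.sym ri≡
      ... | no ri≢  = ⊥-elim (irrefl (sum-≤-tight (λ i → functional-≤ i (r i))
        (trans (sym (∙-choicePoint functional r)) (trans (sym (∙-cong functional eq)) (∙-choicePoint functional (u ∘ toℕ)))) i)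
        (functional-< i (r i) ri≢))

    abstract
      -- Two injections between finite sets take the place of an explicit inverse. The code of a
      -- vertex depends on the functional that comes with it, but the peaks of this functional
      -- determine the vertex.
      vertexCount : ∀ {b} → HasVertexCount (polytope n k s) b → b ≡ walks n origin
      vertexCount {b} count = ℕ.≤-antisym (Fin.injective⇒≤ {f = code} code-injective) (Fin.injective⇒≤ {f = point} point-injective)
        where
        open Bijection count using (to; injective; surjective)

        normal : Fin b → ℕ → Carrier
        normal x = extend (proj₁ (proj₂ (to x)))

        code : Fin b → Fin (walks n origin)
        code x = encode n (peak (normal x)) arc-origin (peak-isWalk (normal x))

        code-injective : ∀ {x y} → code x ≡ code y → x ≡ y
        code-injective {x} {y} eq = injective λ j → trans (vertex≋choicePoint (proj₂ (to x)) j)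
          (trans (choicePoint-cong (λ i → encode-injective 0<s n (peak (normal x)) (peak (normal y)) {walk = peak-isWalk (normal x)} {walk′ = peak-isWalk (normal y)} eq (toℕ i) (Fin.toℕ<n i)) j)
            (sym (vertex≋choicePoint (proj₂ (to y)) j)))

        walkOf : Fin (walks n origin) → ℕ → Fin k
        walkOf z = decode 0<s n origin z

        walkOf-isWalk : ∀ z → IsWalk (walkOf z)
        walkOf-isWalk z = decode-isWalk 0<s n origin z

        point : Fin (walks n origin) → Fin b
        point z = proj₁ (surjective (choicePoint (walkOf z ∘ toℕ) , walk-isVertex (walkOf z) (walkOf-isWalk z)))

        to-point : ∀ z → proj₁ (to (point z)) ≋ choicePoint (walkOf z ∘ toℕ)
        to-point z = proj₂ (surjective (choicePoint (walkOf z ∘ toℕ) , walk-isVertex (walkOf z) (walkOf-isWalk z))) ≡.refl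

        walkOf-determined : ∀ {z z′} → point z ≡ point z′ → ∀ (i : Fin n) → walkOf z (toℕ i) ≡ walkOf z′ (toℕ i)
        walkOf-determined {z} {z′} eq = choicePoint-injective (walkOf z) (walkOf-isWalk z) (walkOf z′ ∘ toℕ)
          λ j → trans (sym (to-point z j)) (trans (reflexive (≡.cong (λ x → proj₁ (to x) j) eq)) (to-point z′ j))

        point-injective : ∀ {z z′} → point z ≡ point z′ → z ≡ z′
        point-injective {z} {z′} eq = decode-injective 0<s n {origin} {z} {z′} λ i i<n →
          ≡.subst (λ l → walkOf z l ≡ walkOf z′ l) (Fin.toℕ-fromℕ< i<n) (walkOf-determined {z} {z′} eq (fromℕ< i<n))

-- Pointwise Lipschitz functions and a boundary point of nonnegativity.

module LocallyLipschitz (R : RealNumbers) where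
  open Summation R public

  -- Continuity at a point with an explicit rate, which sums and products preserve; the cap `d ≤ 1#`
  -- absorbs the quadratic term of a product.
  LipschitzAt : Carrier → (Carrier → Carrier) → Set
  LipschitzAt t h = ∃[ L ] (0# ≤ L × (∀ y d → ∣ y - t ∣≤ d → d ≤ 1# → ∣ h y - h t ∣≤ L * d))

  module _ {t : Carrier} where

    lipschitz-const : ∀ a → LipschitzAt t (λ _ → a)
    lipschitz-const a = 0# , ≤-refl , λ y d _ _ →
      ∣∣≤-cong (sym (-‿inverseʳ a)) (sym (zeroˡ d)) (∣∣≤-refl ≤-refl)

    lipschitz-id : LipschitzAt t (λ y → y)
    lipschitz-id = 1# , <⇒≤ 0<1 , λ y d b _ → ∣∣≤-cong refl (sym (*-identityˡ d)) b

    lipschitz-+ : ∀ {h g} → LipschitzAt t h → LipschitzAt t g → LipschitzAt t (λ y → h y + g y)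
    lipschitz-+ {h} {g} (L , 0≤L , hL) (M , 0≤M , gM) = L + M , 0≤+ 0≤L 0≤M , λ y d b d≤1 →
      ∣∣≤-cong (solve 4 (λ a b c d → (a :- c) :+ (b :- d) := (a :+ b) :- (c :+ d)) refl (h y) (g y) (h t) (g t))
        (sym (distribʳ d L M)) (∣∣≤-+ (hL y d b d≤1) (gM y d b d≤1))

    lipschitz-neg : ∀ {h} → LipschitzAt t h → LipschitzAt t (λ y → - h y)
    lipschitz-neg {h} (L , 0≤L , hL) = L , 0≤L , λ y d b d≤1 →
      ∣∣≤-cong (solve 2 (λ a c → :- (a :- c) := :- a :- :- c) refl (h y) (h t)) refl (∣∣≤-neg (hL y d b d≤1))

    lipschitz-* : ∀ {h g} → LipschitzAt t h → LipschitzAt t g → LipschitzAt t (λ y → h y * g y)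
    lipschitz-* {h} {g} (L , 0≤L , hL) (M , 0≤M , gM) =
      let H , ∣h∣≤H = bound (h t)
          G , ∣g∣≤G = bound (g t)
      in L * M + (L * G + H * M) ,
        0≤+ (0≤* 0≤L 0≤M) (0≤+ (0≤* 0≤L (∣∣≤⇒0≤ ∣g∣≤G)) (0≤* (∣∣≤⇒0≤ ∣h∣≤H) 0≤M)) ,
        λ y d b d≤1 → ∣∣≤-trans
          (∣∣≤-cong (solve 4 (λ a b c d → (a :- c) :* (b :- d) :+ ((a :- c) :* d :+ c :* (b :- d)) := a :* b :- c :* d) refl (h y) (g y) (h t) (g t)) refl
            (∣∣≤-+ (∣∣≤-* (hL y d b d≤1) (gM y d b d≤1)) (∣∣≤-+ (∣∣≤-* (hL y d b d≤1) ∣g∣≤G) (∣∣≤-* ∣h∣≤H (gM y d b d≤1)))))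
          (≤-intro (0≤* (0≤* (0≤* 0≤L 0≤M) (∣∣≤⇒0≤ b)) (≤-difference d≤1))
            (solve 5 (λ l m h g d → l :* d :* (m :* d) :+ (l :* d :* g :+ h :* (m :* d)) :+ l :* m :* d :* (con (+ 1) :- d)
              := (l :* m :+ (l :* g :+ h :* m)) :* d) refl L M H G d))

    lipschitz-sum : ∀ {n} {h : Fin n → Carrier → Carrier} → (∀ i → LipschitzAt t (h i)) → LipschitzAt t (λ y → sum λ i → h i y)
    lipschitz-sum {zero}  p = lipschitz-const 0#
    lipschitz-sum {suc n} p = lipschitz-+ (p zero) (lipschitz-sum (p ∘ suc))

    lipschitz-^ : ∀ n → LipschitzAt t (_^ n)
    lipschitz-^ zero    = lipschitz-const 1#
    lipschitz-^ (suc n) = lipschitz-* lipschitz-id (lipschitz-^ n)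

  small : ∀ L η → 0# ≤ L → 0# < η → ∃[ d ] (0# < d × d ≤ 1# × L * d < η)
  small L η 0≤L 0<η = d , 0<d , d≤1 , <-intro (0<* 0<d (0<+ 0<η (<⇒≤ 0<1)))
      (trans (solve 3 (λ l d e → l :* d :+ d :* (e :+ con (+ 1)) := (e :+ (l :+ con (+ 1))) :* d) refl L d η) sd≈η)
    where
    s = η + (L + 1#)
    0<s : 0# < s
    0<s = 0<+ 0<η (0≤+ 0≤L (<⇒≤ 0<1))
    -- At most 1 because `η` is a summand of `s`; and `L * d` falls short of `η` by `d * (η + 1#)`.
    d = η * s ⁻¹
    0<d = 0<* 0<η (0<⁻¹ 0<s)
    sd≈η : s * d ≈ η
    sd≈η = trans (solve 3 (λ s e i → s :* (e :* i) := (s :* i) :* e) refl s η (s ⁻¹)) (trans (*-congʳ (*-⁻¹ 0<s)) (*-identityˡ η))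
    d≤1 : d ≤ 1#
    d≤1 = *-cancelˡ-≤ 0<s (≤-respˡ (sym sd≈η) (≤-respʳ (sym (*-identityʳ s)) (≤-intro (0≤+ 0≤L (<⇒≤ 0<1)) refl)))

  positive-nearby : ∀ {t h} → LipschitzAt t h → 0# < h t →
    ∃[ δ ] (0# < δ × δ ≤ 1# × (∀ d → 0# ≤ d → d ≤ δ → 0# < h (t + d)))
  positive-nearby {t} {h} (L , 0≤L , hL) 0<ht =
    let δ , 0<δ , δ≤1 , Lδ<ht = small L (h t) 0≤L 0<ht
    in δ , 0<δ , δ≤1 , λ d 0≤d d≤δ →
      let ∣t+d-t∣≤δ = ∣∣≤-trans (∣∣≤-cong (solve 2 (λ t d → d := t :+ d :- t) refl t d) refl (∣∣≤-refl 0≤d)) d≤δ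
      in <-≤-trans (<-difference Lδ<ht) (≤-intro
        (≤-difference (proj₁ (hL (t + d) δ ∣t+d-t∣≤δ δ≤1)))
        (solve 3 (λ a b l → a :- l :+ (b :- a :- :- l) := b) refl (h t) (h (t + d)) (L * δ)))

  nonnegative-closed : ∀ {t h} → LipschitzAt t h →
    (∀ δ → 0# < δ → ∃[ y ] (∣ y - t ∣≤ δ × 0# ≤ h y)) → 0# ≤ h t
  nonnegative-closed {t} {h} (L , 0≤L , hL) near with <⊎≥ (h t) 0#
  ... | inj₂ 0≤ht = 0≤ht
  ... | inj₁ ht<0 =
    let δ , 0<δ , δ≤1 , Lδ< = small L (- h t) 0≤L (<-respʳ-≈ (+-identityˡ _) (<-difference ht<0))
        y , y-t , 0≤hy = near δ 0<δ
    in ⊥-elim (≤⇒≯ 0≤hy (≤-<-trans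
      (≤-intro (≤-difference (proj₂ (hL y δ y-t δ≤1)))
        (solve 3 (λ a b l → a :+ (l :- (a :- b)) := l :+ b) refl (h y) (h t) (L * δ)))
      (<-respʳ-≈ (-‿inverseˡ (h t)) (+-mono-< (L * δ) (- h t) (h t) Lδ<))))

  module FirstZero {h₁ h₂ h₃ : Carrier → Carrier}
    (lip₁ : ∀ t → LipschitzAt t h₁) (lip₂ : ∀ t → LipschitzAt t h₂) (lip₃ : ∀ t → LipschitzAt t h₃) where

    Nonnegative Positive : Carrier → Set
    Nonnegative t = 0# ≤ h₁ t × 0# ≤ h₂ t × 0# ≤ h₃ t
    Positive t    = 0# < h₁ t × 0# < h₂ t × 0# < h₃ t

    advance : ∀ t → Positive t → ∃[ y ] (t < y × Nonnegative y)
    advance t (p₁ , p₂ , p₃) =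
      let δ₁ , 0<δ₁ , δ₁≤1 , q₁ = positive-nearby (lip₁ t) p₁
          δ₂ , 0<δ₂ , δ₂≤1 , q₂ = positive-nearby (lip₂ t) p₂
          δ₃ , 0<δ₃ , δ₃≤1 , q₃ = positive-nearby (lip₃ t) p₃
          -- A product of radii that are at most 1 lies below each of them and serves as their
          -- minimum.
          d   = δ₁ * (δ₂ * δ₃)
          0<d = 0<* 0<δ₁ (0<* 0<δ₂ 0<δ₃)
          d≤δ₂δ₃ = *-≤ʳ (<⇒≤ (0<* 0<δ₂ 0<δ₃)) δ₁≤1
      in t + d , <-intro 0<d refl ,
        <⇒≤ (q₁ d (<⇒≤ 0<d) (*-≤ˡ (<⇒≤ 0<δ₁) (≤-trans (*-≤ˡ (<⇒≤ 0<δ₂) δ₃≤1) δ₂≤1))) ,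
        <⇒≤ (q₂ d (<⇒≤ 0<d) (≤-trans d≤δ₂δ₃ (*-≤ˡ (<⇒≤ 0<δ₂) δ₃≤1))) ,
        <⇒≤ (q₃ d (<⇒≤ 0<d) (≤-trans d≤δ₂δ₃ (*-≤ʳ (<⇒≤ 0<δ₃) δ₂≤1)))
      where
      *-≤ˡ : ∀ {x y} → 0# ≤ x → y ≤ 1# → x * y ≤ x
      *-≤ˡ 0≤x y≤1 = ≤-respʳ (*-identityʳ _) (*-monoˡ-≤ 0≤x y≤1)
      *-≤ʳ : ∀ {x y} → 0# ≤ y → x ≤ 1# → x * y ≤ y
      *-≤ʳ 0≤y x≤1 = ≤-respʳ (*-identityˡ _) (*-monoʳ-≤ 0≤y x≤1)

    -- The point is the supremum of all `t ≥ 0` at which the three functions are nonnegative.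
    -- Nonnegativity passes to the supremum, and if all three were positive there, `advance` would
    -- lead beyond it.
    first-zero : Positive 0# → (∃[ b ] (∀ t → 0# ≤ t → Nonnegative t → t ≤ b)) →
      ∃[ t ] (0# < t × Nonnegative t × ¬ Positive t)
    first-zero pos₀ (b , ≤b) with
      sup (λ t → 0# ≤ t × Nonnegative t)
        (0# , ≤-refl , <⇒≤ (proj₁ pos₀) , <⇒≤ (proj₁ (proj₂ pos₀)) , <⇒≤ (proj₂ (proj₂ pos₀)))
        (b , λ t (0≤t , nonneg) → ≤b t 0≤t nonneg)
    ... | σ , upper , approx = σ , 0<σ ,
        (nonnegative-closed (lip₁ σ) (λ δ 0<δ → let y , y-σ , n = near δ 0<δ in y , y-σ , proj₁ n) ,
         nonnegative-closed (lip₂ σ) (λ δ 0<δ → let y , y-σ , n = near δ 0<δ in y , y-σ , proj₁ (proj₂ n)) ,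
         nonnegative-closed (lip₃ σ) (λ δ 0<δ → let y , y-σ , n = near δ 0<δ in y , y-σ , proj₂ (proj₂ n))) ,
        λ pos → let y , σ<y , nonneg = advance σ pos in ≤⇒≯ (upper y (<⇒≤ (<-trans 0<σ σ<y) , nonneg)) σ<y
      where
      0<σ : 0# < σ
      0<σ = let y , 0<y , nonneg = advance 0# pos₀ in <-≤-trans 0<y (upper y (<⇒≤ 0<y , nonneg))
      near : ∀ δ → 0# < δ → ∃[ y ] (∣ y - σ ∣≤ δ × Nonnegative y)
      near δ 0<δ with approx (σ - δ) (<-intro 0<δ (solve 2 (λ s d → s :- d :+ d := s) refl σ δ))
      ... | y , y∈@(_ , nonneg) , σ-δ<y = y , ∣∣≤-intro
        (≤-respʳ (solve 3 (λ y s d → y :- (s :- d) := d :+ (y :- s)) refl y σ δ) (≤-difference (<⇒≤ σ-δ<y)))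
        (≤-respʳ (solve 3 (λ y s d → d :+ (s :- y) := d :- (y :- s)) refl y σ δ) (0≤+ (<⇒≤ 0<δ) (≤-difference (upper y y∈)))) , nonneg

-- Bounds on the number of walks from eigenvectors.

module Spectrum (R : RealNumbers) {k s : ℕ} (0<s : 0 ℕ.< s) (s<k : s ℕ.< k) where
  open LocallyLipschitz R public
  open VertexCount R 0<s s<k using (origin; arc-origin)
  open Digraph {k} {s} s<k
  open Mult semiring using (×-homo-+)
  open import Relation.Binary.Reasoning.Setoid setoid

  private
    A : Matrix k
    A = adjacencyMatrix k s

  0≤if : ∀ b → 0# ≤ (if b then 1# else 0#)
  0≤if true  = <⇒≤ 0<1
  0≤if false = ≤-refl

  term-≤-sum : ∀ {n} {f : Fin n → Carrier} → (∀ i → 0# ≤ f i) → ∀ i → f i ≤ sum f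
  term-≤-sum 0≤f zero    = ≤-intro (0≤sum (0≤f ∘ suc)) refl
  term-≤-sum 0≤f (suc i) = ≤-trans (term-≤-sum (0≤f ∘ suc) i) (≤-intro (0≤f zero) (+-comm _ _))

  fromℕ-sum : ∀ {n} (f : Fin n → ℕ) → fromℕ (sumℕ f) ≈ sum (fromℕ ∘ f)
  fromℕ-sum {zero}  f = refl
  fromℕ-sum {suc n} f = trans (×-homo-+ 1# (f zero) _) (+-congˡ (fromℕ-sum (f ∘ suc)))

  fromℕ-if : ∀ b n → fromℕ (if b then n else 0) ≈ (if b then 1# else 0#) * fromℕ n
  fromℕ-if true  n = sym (*-identityˡ _)
  fromℕ-if false n = sym (zeroˡ _)

  walks-step : ∀ n u → fromℕ (walks (suc n) u) ≈ sum λ v → A u v * fromℕ (walks n v)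
  walks-step n u = trans (fromℕ-sum (walksVia n u)) (sum-cong-≋ λ v → fromℕ-if (does (arc? k s u v)) (walks n v))

  walksVia-≤ : ∀ n u v → walksVia n u v ℕ.≤ walks n v
  walksVia-≤ n u v with does (arc? k s u v)
  ... | true  = ℕ.≤-refl
  ... | false = ℕ.z≤n

  walksVia-origin : ∀ n v → walksVia n origin v ≡ walks n v
  walksVia-origin n v = ≡.cong (if_then walks n v else 0) (dec-true (arc? k s origin v) arc-origin)

  sumℕ-mono-≤ : ∀ {n} {f g : Fin n → ℕ} → (∀ i → f i ℕ.≤ g i) → sumℕ f ℕ.≤ sumℕ g
  sumℕ-mono-≤ {zero}  p = ℕ.z≤n
  sumℕ-mono-≤ {suc n} p = ℕ.+-mono-≤ (p zero) (sumℕ-mono-≤ (p ∘ suc))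

  -- The row of `origin` in the adjacency matrix is all ones and dominates every other row.
  walks-origin-maximal : ∀ n u → walks n u ℕ.≤ walks n origin
  walks-origin-maximal zero    u = ℕ.≤-refl
  walks-origin-maximal (suc n) u = sumℕ-mono-≤ λ v →
    ≡.subst (walksVia n u v ℕ.≤_) (≡.sym (walksVia-origin n v)) (walksVia-≤ n u v)

  -- Powers of the nonnegative matrix preserve the comparison of `v` with the constant vector `M`,
  -- whose images count walks. Absolute values are needed because the entries of `v` may differ in
  -- sign.
  eigenvector-bound : ∀ {μ} {v : Point k} {M} → (λ i → sum λ j → A i j * v j) ≋ (λ i → μ * v i) →
    (∀ u → ∣ v u ∣≤ M) → ∀ n u → ∣ μ ^ n * v u ∣≤ M * fromℕ (walks n u)
  eigenvector-bound eig v≤M zero u = ∣∣≤-cong (sym (*-identityˡ _)) (sym (trans (*-congˡ (+-identityʳ 1#)) (*-identityʳ _))) (v≤M u)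
  eigenvector-bound {μ} {v} {M} eig v≤M (suc n) u = ∣∣≤-cong left right
    (sum-∣∣≤ λ w → ∣∣≤-* (∣∣≤-refl (0≤if (does (arc? k s u w)))) (eigenvector-bound eig v≤M n w))
    where
    left : sum (λ w → A u w * (μ ^ n * v w)) ≈ μ ^ suc n * v u
    left = begin
      sum (λ w → A u w * (μ ^ n * v w))   ≈⟨ sum-cong-≋ (λ w → solve 3 (λ a m v → a :* (m :* v) := m :* (a :* v)) refl (A u w) (μ ^ n) (v w)) ⟩
      sum (λ w → μ ^ n * (A u w * v w))   ≈⟨ *-distribˡ-sum (μ ^ n) (λ w → A u w * v w) ⟨
      μ ^ n * sum (λ w → A u w * v w)     ≈⟨ *-congˡ (eig u) ⟩
      μ ^ n * (μ * v u)                   ≈⟨ solve 3 (λ p m v → p :* (m :* v) := m :* p :* v) refl (μ ^ n) μ (v u) ⟩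
      μ ^ suc n * v u                     ∎
    right : sum (λ w → A u w * (M * fromℕ (walks n w))) ≈ M * fromℕ (walks (suc n) u)
    right = begin
      sum (λ w → A u w * (M * fromℕ (walks n w)))   ≈⟨ sum-cong-≋ (λ w → solve 3 (λ a m v → a :* (m :* v) := m :* (a :* v)) refl (A u w) M (fromℕ (walks n w))) ⟩
      sum (λ w → M * (A u w * fromℕ (walks n w)))   ≈⟨ *-distribˡ-sum M (λ w → A u w * fromℕ (walks n w)) ⟨
      M * sum (λ w → A u w * fromℕ (walks n w))     ≈⟨ *-congˡ (walks-step n u) ⟨
      M * fromℕ (walks (suc n) u)                   ∎

  abstract
    walks-lower-bound : ∀ {μ} → IsEigenvalue A μ →
      ∃[ c ] ∃[ M ] (0# < c × 0# ≤ M × (∀ n → c * μ ^ n ≤ M * fromℕ (walks n origin)))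
    walks-lower-bound {μ} (v , v≉0 , eig) = let u , vu≉0 = nonzero in choose u vu≉0
      where
      M : Carrier
      M = sum λ u → proj₁ (bound (v u))
      0≤bound : ∀ u → 0# ≤ proj₁ (bound (v u))
      0≤bound u = ∣∣≤⇒0≤ (proj₂ (bound (v u)))
      v≤M : ∀ u → ∣ v u ∣≤ M
      v≤M u = ∣∣≤-trans (proj₂ (bound (v u))) (term-≤-sum 0≤bound u)
      0≤M : 0# ≤ M
      0≤M = 0≤sum 0≤bound
      nonzero : ∃[ u ] ¬ v u ≈ 0#
      nonzero = Fin.¬∀⟶∃¬ k (λ u → v u ≈ 0#) (λ u → v u ≟ 0#) v≉0
      to-origin : ∀ n u → M * fromℕ (walks n u) ≤ M * fromℕ (walks n origin)
      to-origin n u = *-monoˡ-≤ 0≤M (fromℕ-mono-≤ (walks-origin-maximal n u))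
      choose : ∀ u → ¬ v u ≈ 0# → ∃[ c ] ∃[ M ] (0# < c × 0# ≤ M × (∀ n → c * μ ^ n ≤ M * fromℕ (walks n origin)))
      -- The sign of the nonzero entry decides whether the upper or the lower half of the bound is
      -- used.
      choose u vu≉0 with compare 0# (v u)
      ... | tri≈ _ eq _ = ⊥-elim (vu≉0 (sym eq))
      ... | tri< 0<v _ _ = v u , M , 0<v , 0≤M , λ n → ≤-respˡ (*-comm _ _)
        (≤-trans (proj₂ (eigenvector-bound {v = v} eig v≤M n u)) (to-origin n u))
      ... | tri> _ _ v<0 = - v u , M , <-respʳ-≈ (+-identityˡ _) (<-difference v<0) , 0≤M , λ n →
        ≤-respˡ (solve 2 (λ p v → :- (p :* v) := :- v :* p) refl (μ ^ n) (v u))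
          (≤-trans (proj₂ (∣∣≤-neg (eigenvector-bound {v = v} eig v≤M n u))) (to-origin n u))

  positive-lower-bound : ∀ {n} (x : Fin n → Carrier) → (∀ i → 0# < x i) → ∃[ m ] (0# < m × (∀ i → m ≤ x i))
  positive-lower-bound {zero}  x 0<x = 1# , 0<1 , λ ()
  positive-lower-bound {suc n} x 0<x with positive-lower-bound (x ∘ suc) (0<x ∘ suc)
  ... | m , 0<m , m≤ with <⊎≥ m (x zero)
  ...   | inj₁ m<x₀ = m , 0<m , λ { zero → <⇒≤ m<x₀ ; (suc i) → m≤ i }
  ...   | inj₂ x₀≤m = x zero , 0<x zero , λ { zero → ≤-refl ; (suc i) → ≤-trans x₀≤m (m≤ i) }

  abstract
    -- With `m` a positive lower bound of the entries, the all-ones vector times `m` stays below the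
    -- eigenvector under powers of the matrix; hence `B` is `x origin` divided by `m`.
    walks-upper-bound : ∀ {ν} {x : Point k} → (λ i → sum λ j → A i j * x j) ≋ (λ i → ν * x i) → (∀ u → 0# < x u) →
      ∃[ B ] (0# < B × (∀ n → fromℕ (walks n origin) ≤ B * ν ^ n))
    walks-upper-bound {ν} {x} eig 0<x with positive-lower-bound x 0<x
    ... | m , 0<m , m≤x = m ⁻¹ * x origin , 0<* (0<⁻¹ 0<m) (0<x origin) , λ n →
      ≤-respˡ (trans (solve 3 (λ i m w → i :* (m :* w) := (m :* i) :* w) refl (m ⁻¹) m _) (trans (*-congʳ (*-⁻¹ 0<m)) (*-identityˡ _)))
        (≤-respʳ (solve 3 (λ i p x → i :* (p :* x) := i :* x :* p) refl (m ⁻¹) (ν ^ n) (x origin))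
          (*-monoˡ-≤ (<⇒≤ (0<⁻¹ 0<m)) (induct n origin)))
      where
      induct : ∀ n u → m * fromℕ (walks n u) ≤ ν ^ n * x u
      induct zero    u = ≤-respˡ (sym (trans (*-congˡ (+-identityʳ 1#)) (*-identityʳ _))) (≤-respʳ (sym (*-identityˡ _)) (m≤x u))
      induct (suc n) u = ≤-respˡ
        (trans (sum-cong-≋ λ w → solve 3 (λ a m v → a :* (m :* v) := m :* (a :* v)) refl (A u w) m (fromℕ (walks n w)))
          (trans (sym (*-distribˡ-sum m (λ w → A u w * fromℕ (walks n w)))) (*-congˡ (sym (walks-step n u)))))
        (≤-respʳ
          (trans (sum-cong-≋ λ w → solve 3 (λ a m v → a :* (m :* v) := m :* (a :* v)) refl (A u w) (ν ^ n) (x w))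
            (trans (sym (*-distribˡ-sum (ν ^ n) (λ w → A u w * x w))) (trans (*-congˡ (eig u))
              (solve 3 (λ p n x → p :* (n :* x) := n :* p :* x) refl (ν ^ n) ν (x u)))))
          (sum-mono-≤ λ w → *-monoˡ-≤ (0≤if (does (arc? k s u w))) (induct n w)))

-- Construction of a positive eigenvector.

module Perron (R : RealNumbers) {k s : ℕ} (0<s : 0 ℕ.< s) (s<k : s ℕ.< k) where
  open LocallyLipschitz R public
  open Functionals R using (∙-basis; basis-same; basis-other)
  open VertexCount R 0<s s<k using (origin; 0<k)
  open Digraph {k} {s} s<k
  open Spectrum R 0<s s<k using (term-≤-sum; 0≤if)
  open import Relation.Binary.Reasoning.Setoid setoid

  private
    instance
      s≢0 : ℕ.NonZero s
      s≢0 = ℕ.>-nonZero 0<s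

    A : Matrix k
    A = adjacencyMatrix k s

  -- The vertices fall into blocks of s consecutive ones, the last of them possibly shorter.
  block : Fin k → ℕ
  block u = toℕ u ℕ./ s

  -- The sum `t + … + t^q`, in the recursive form that passing from `x_{u-s}` to `x_u` imposes on
  -- the coefficient of `H`.
  geometric : Carrier → ℕ → Carrier
  geometric t zero    = 0#
  geometric t (suc q) = t * (geometric t q + 1#)

  high : Fin k → Carrier
  high u = if does (k ∸ s ℕ.≤? toℕ u) then 1# else 0#

  high-yes : ∀ {u} → k ∸ s ℕ.≤ toℕ u → high u ≡ 1#
  high-yes {u} p = ≡.cong (if_then 1# else 0#) (dec-true (k ∸ s ℕ.≤? toℕ u) p)

  high-no : ∀ {u} → ¬ k ∸ s ℕ.≤ toℕ u → high u ≡ 0#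
  high-no {u} p = ≡.cong (if_then 1# else 0#) (dec-false (k ∸ s ℕ.≤? toℕ u) p)

  0≤high : ∀ u → 0# ≤ high u
  0≤high u = 0≤if (does (k ∸ s ℕ.≤? toℕ u))

  A-arc : ∀ {u v} → Arc k s u v → A u v ≡ 1#
  A-arc {u} {v} p = ≡.cong (if_then 1# else 0#) (dec-true (arc? k s u v) p)

  A-no-arc : ∀ {u v} → ¬ Arc k s u v → A u v ≡ 0#
  A-no-arc {u} {v} p = ≡.cong (if_then 1# else 0#) (dec-false (arc? k s u v) p)

  P G Pₕ Gₕ : Carrier → Carrier
  P t  = sum λ u → t ^ suc (block u)
  G t  = sum λ u → geometric t (block u)
  Pₕ t = sum λ u → high u * t ^ suc (block u)
  Gₕ t = sum λ u → high u * geometric t (block u)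

  -- An eigenvector for the eigenvalue 1/t with total mass T and mass H on the vertices
  -- ≥ k - s has the entries x_u = t T for u < s and x_u = t (x_{u-s} + H) for u ≥ s, so
  -- that x_u = T t^{q+1} + H (t + … + t^q) for u in block q.  Consistency amounts to
  -- T = T P + H G and H = T Pₕ + H Gₕ.
  h₁ h₂ h₃ : Carrier → Carrier
  h₁ t = 1# + - P t
  h₂ t = 1# + - Gₕ t
  h₃ t = h₁ t * h₂ t + - (G t * Pₕ t)

  module _ {t : Carrier} where
    lipschitz-geometric : ∀ q → LipschitzAt t (λ y → geometric y q)
    lipschitz-geometric zero    = lipschitz-const 0#
    lipschitz-geometric (suc q) = lipschitz-* lipschitz-id (lipschitz-+ (lipschitz-geometric q) (lipschitz-const 1#))

    lipschitz-h₁ : LipschitzAt t h₁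
    lipschitz-h₁ = lipschitz-+ (lipschitz-const 1#) (lipschitz-neg (lipschitz-sum λ u → lipschitz-^ (suc (block u))))

    lipschitz-h₂ : LipschitzAt t h₂
    lipschitz-h₂ = lipschitz-+ (lipschitz-const 1#) (lipschitz-neg
      (lipschitz-sum λ u → lipschitz-* (lipschitz-const (high u)) (lipschitz-geometric (block u))))

    lipschitz-h₃ : LipschitzAt t h₃
    lipschitz-h₃ = lipschitz-+ (lipschitz-* lipschitz-h₁ lipschitz-h₂) (lipschitz-neg
      (lipschitz-* (lipschitz-sum λ u → lipschitz-geometric (block u))
        (lipschitz-sum λ u → lipschitz-* (lipschitz-const (high u)) (lipschitz-^ (suc (block u))))))

  0≤geometric : ∀ {t} → 0# ≤ t → ∀ q → 0# ≤ geometric t q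
  0≤geometric 0≤t zero    = ≤-refl
  0≤geometric 0≤t (suc q) = 0≤* 0≤t (0≤+ (0≤geometric 0≤t q) (<⇒≤ 0<1))

  block-low : ∀ {u} → toℕ u ℕ.< s → block u ≡ 0
  block-low = m<n⇒m/n≡0

  block-origin : block origin ≡ 0
  block-origin = block-low (≡.subst (ℕ._< s) (≡.sym (Fin.toℕ-fromℕ< 0<k)) 0<s)

  module _ {u : Fin k} (s≤u : s ℕ.≤ toℕ u) where
    back-< : toℕ u ∸ s ℕ.< k ∸ s
    back-< = ℕ.∸-monoˡ-< (Fin.toℕ<n u) s≤u

    back : Fin k
    back = fromℕ< (ℕ.<-≤-trans back-< (ℕ.m∸n≤m k s))

    toℕ-back : toℕ back ≡ toℕ u ∸ s
    toℕ-back = Fin.toℕ-fromℕ< _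

    block-back : block u ≡ suc (block back)
    block-back = ≡.trans (m/n≡1+[m∸n]/n s≤u) (≡.cong (λ l → suc (l ℕ./ s)) (≡.sym toℕ-back))

    -- Since `back` is `u - s < k - s`, it is not a high vertex and the two indicators never
    -- overlap; `arc-cases` excludes all other arcs.
    row-high : ∀ v → A u v ≈ high v + basis back v
    row-high v = by-cases (k ∸ s ℕ.≤? toℕ v) (v Fin.≟ back)
      where
      entries : ∀ {a b c} → A u v ≡ a → high v ≡ b → basis back v ≡ c → b + c ≈ a → A u v ≈ high v + basis back v
      entries p q r eq = trans (reflexive p) (trans (sym eq) (sym (+-cong (reflexive q) (reflexive r))))

      no-arc : ¬ k ∸ s ℕ.≤ toℕ v → v ≢ back → ¬ Arc k s u v
      no-arc k-s≰v v≢back arc with arc-cases arc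
      ... | inj₁ u<s = ℕ.<⇒≱ u<s s≤u
      ... | inj₂ (inj₁ k-s≤v) = k-s≰v k-s≤v
      ... | inj₂ (inj₂ u≡s+v) = v≢back (Fin.toℕ-injective (≡.sym (≡.trans toℕ-back
        (≡.trans (≡.cong (_∸ s) u≡s+v) (ℕ.m+n∸m≡n s (toℕ v))))))

      u≡s+back : toℕ u ≡ s ℕ.+ toℕ back
      u≡s+back = ≡.sym (≡.trans (≡.cong (s ℕ.+_) toℕ-back) (ℕ.m+[n∸m]≡n s≤u))

      by-cases : Dec (k ∸ s ℕ.≤ toℕ v) → Dec (v ≡ back) → A u v ≈ high v + basis back v
      by-cases (yes k-s≤v) (yes v≡back) = ⊥-elim (ℕ.<⇒≱ back-<
        (≡.subst (k ∸ s ℕ.≤_) (≡.trans (≡.cong toℕ v≡back) toℕ-back) k-s≤v))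
      by-cases (yes k-s≤v) (no v≢back)  = entries (A-arc (arc-high k-s≤v)) (high-yes k-s≤v) (basis-other v≢back) (+-identityʳ 1#)
      by-cases (no k-s≰v)  (yes ≡.refl) = entries (A-arc (arc-shift u≡s+back)) (high-no k-s≰v) (basis-same back) (+-identityˡ 1#)
      by-cases (no k-s≰v)  (no v≢back)  = entries (A-no-arc (no-arc k-s≰v v≢back)) (high-no k-s≰v) (basis-other v≢back) (+-identityˡ 0#)

  module _ {t} (0<t : 0# < t) where
    -- Strictness comes from the vertex `s`, which exists because `s < k` and lies in block 1.
    0<G : 0# < G t
    0<G = <-≤-trans (≡.subst (λ q → 0# < geometric t q) (≡.sym block≡1) 0<geometric1)
      (term-≤-sum (λ u → 0≤geometric (<⇒≤ 0<t) (block u)) (fromℕ< s<k))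
      where
      s≤ : s ℕ.≤ toℕ (fromℕ< s<k)
      s≤ = ℕ.≤-reflexive (≡.sym (Fin.toℕ-fromℕ< s<k))
      block≡1 : block (fromℕ< s<k) ≡ 1
      block≡1 = ≡.trans (block-back s≤) (≡.cong suc (block-low
        (≡.subst (ℕ._< s) (≡.sym (≡.trans (toℕ-back s≤) (≡.trans (≡.cong (_∸ s) (Fin.toℕ-fromℕ< s<k)) (ℕ.n∸n≡0 s)))) 0<s)))
      0<geometric1 : 0# < geometric t 1
      0<geometric1 = 0<* 0<t (<-respʳ-≈ (sym (+-identityˡ 1#)) 0<1)

    0<Pₕ : 0# < Pₕ t
    0<Pₕ = <-≤-trans (<-respʳ-≈ (sym (trans (*-congʳ (reflexive (high-yes last-high))) (*-identityˡ _))) (0<^ 0<t (suc (block (lastVertex 0<s)))))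
      (term-≤-sum (λ u → 0≤* (0≤high u) (0≤^ (<⇒≤ 0<t) (suc (block u)))) (lastVertex 0<s))
      where
      last-high : k ∸ s ℕ.≤ toℕ (lastVertex 0<s)
      last-high = ≡.subst (k ∸ s ℕ.≤_) (≡.sym (Fin.toℕ-fromℕ< _)) (ℕ.∸-monoʳ-≤ k 0<s)

  sum-0 : ∀ {n} {f : Fin n → Carrier} → (∀ i → f i ≈ 0#) → sum f ≈ 0#
  sum-0 {n} p = trans (sum-cong-≋ p) (sum-replicate-zero n)

  1-0 : ∀ {x} → x ≈ 0# → 0# < 1# + - x
  1-0 {x} x≈0 = <-respʳ-≈ (trans (solve 0 (con (+ 1) := con (+ 1) :+ :- con (+ 0)) refl) (+-congˡ (-‿cong (sym x≈0)))) 0<1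

  open FirstZero {h₁} {h₂} {h₃} (λ t → lipschitz-h₁) (λ t → lipschitz-h₂) (λ t → lipschitz-h₃)

  geometric-0 : ∀ q → geometric 0# q ≈ 0#
  geometric-0 zero    = refl
  geometric-0 (suc q) = zeroˡ _

  positive-at-0 : Positive 0#
  positive-at-0 = 0<h₁ , 0<h₂ , <-respʳ-≈
    (trans (solve 1 (λ p → p := p :+ :- con (+ 0)) refl (h₁ 0# * h₂ 0#)) (+-congˡ (-‿cong (sym (trans (*-congʳ G≈0) (zeroˡ _))))))
    (0<* 0<h₁ 0<h₂)
    where
    G≈0 : G 0# ≈ 0#
    G≈0 = sum-0 λ u → geometric-0 (block u)
    0<h₁ : 0# < h₁ 0#
    0<h₁ = 1-0 (sum-0 {k} λ u → zeroˡ _)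
    0<h₂ : 0# < h₂ 0#
    0<h₂ = 1-0 (sum-0 {k} λ u → trans (*-congˡ (geometric-0 (block u))) (zeroʳ _))

  -- The summand of `origin` in `P t` is `t` itself, and `0# ≤ h₁ t` bounds `P t` by 1.
  nonnegative⇒≤1 : ∀ t → 0# ≤ t → Nonnegative t → t ≤ 1#
  nonnegative⇒≤1 t 0≤t (0≤h₁ , _) = ≤-trans
    (≤-respˡ (*-identityʳ t) (≡.subst (λ q → t ^ suc q ≤ P t) block-origin (term-≤-sum (λ u → 0≤^ 0≤t (suc (block u))) origin)))
    (≤-intro 0≤h₁ (solve 1 (λ p → p :+ (con (+ 1) :+ :- p) := con (+ 1)) refl (P t)))

  module Eigenvector {t} (0<t : 0# < t) (nonneg : Nonnegative t) (not-positive : ¬ Positive t) where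

    -- If `h₃ t` were positive, `h₁ t * h₂ t` would exceed `G t * Pₕ t > 0`; the two nonnegative
    -- factors would then be positive as well, contrary to `not-positive`.
    h₃≈0 : h₃ t ≈ 0#
    h₃≈0 = ≤-antisym (≮⇒≥ λ 0<h₃ → not-positive (positive-factors 0<h₃)) (proj₂ (proj₂ nonneg))
      where
      positive-factors : 0# < h₃ t → Positive t
      positive-factors 0<h₃ = 0<h₁ , 0<h₂ , 0<h₃
        where
        0<h₁h₂ : 0# < h₁ t * h₂ t
        0<h₁h₂ = <-respʳ-≈ (solve 2 (λ a b → a :+ :- b :+ b := a) refl (h₁ t * h₂ t) (G t * Pₕ t))
          (0<+ 0<h₃ (<⇒≤ (0<* (0<G 0<t) (0<Pₕ 0<t))))
        0<h₁ : 0# < h₁ t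
        0<h₁ with proj₁ nonneg
        ... | inj₁ p = p
        ... | inj₂ 0≈h₁ = ⊥-elim (irrefl (sym (trans (*-congʳ (sym 0≈h₁)) (zeroˡ _))) 0<h₁h₂)
        0<h₂ : 0# < h₂ t
        0<h₂ with proj₁ (proj₂ nonneg)
        ... | inj₁ p = p
        ... | inj₂ 0≈h₂ = ⊥-elim (irrefl (sym (trans (*-congˡ (sym 0≈h₂)) (zeroʳ _))) 0<h₁h₂)

    0<h₂ : 0# < h₂ t
    0<h₂ with proj₁ (proj₂ nonneg)
    ... | inj₁ p = p
    ... | inj₂ 0≈h₂ = ⊥-elim (irrefl (sym GPₕ≈0) (0<* (0<G 0<t) (0<Pₕ 0<t)))
      where
      GPₕ≈0 : G t * Pₕ t ≈ 0#
      GPₕ≈0 = begin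
        G t * Pₕ t             ≈⟨ solve 2 (λ a b → b := a :- (a :+ :- b)) refl (h₁ t * h₂ t) (G t * Pₕ t) ⟩
        h₁ t * h₂ t - h₃ t     ≈⟨ +-cong (trans (*-congˡ (sym 0≈h₂)) (zeroʳ _)) (-‿cong h₃≈0) ⟩
        0# - 0#                ≈⟨ -‿inverseʳ 0# ⟩
        0#                     ∎

    -- A kernel vector of the singular system: this choice satisfies the equation for `H`
    -- identically, and the equation for `T` becomes `h₃ t ≈ 0#`.
    T H : Carrier
    T = h₂ t
    H = Pₕ t

    x : Fin k → Carrier
    x u = T * t ^ suc (block u) + H * geometric t (block u)

    0<x : ∀ u → 0# < x u
    0<x u = 0<+ (0<* 0<h₂ (0<^ 0<t (suc (block u)))) (0≤* (<⇒≤ (0<Pₕ 0<t)) (0≤geometric (<⇒≤ 0<t) (block u)))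

    total : sum x ≈ T
    total = begin
      sum x                                                             ≈⟨ ∑-distrib-+ (λ u → T * t ^ suc (block u)) (λ u → H * geometric t (block u)) ⟩
      sum (λ u → T * t ^ suc (block u)) + sum (λ u → H * geometric t (block u))
        ≈⟨ +-cong (*-distribˡ-sum T (λ u → t ^ suc (block u))) (*-distribˡ-sum H (λ u → geometric t (block u))) ⟨
      T * P t + H * G t
        ≈⟨ solve 4 (λ p g pₕ h₂ → h₂ :* p :+ pₕ :* g := h₂ :- ((con (+ 1) :+ :- p) :* h₂ :+ :- (g :* pₕ))) refl (P t) (G t) (Pₕ t) (h₂ t) ⟩
      T - h₃ t                                                          ≈⟨ +-congˡ (-‿cong h₃≈0) ⟩
      T - 0#                                                            ≈⟨ solve 1 (λ a → a :- con (+ 0) := a) refl T ⟩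
      T                                                                 ∎

    total-high : sum (λ u → high u * x u) ≈ H
    total-high = begin
      sum (λ u → high u * x u)
        ≈⟨ sum-cong-≋ (λ u → solve 5 (λ h a p b g → h :* (a :* p :+ b :* g) := a :* (h :* p) :+ b :* (h :* g)) refl (high u) T (t ^ suc (block u)) H (geometric t (block u))) ⟩
      sum (λ u → T * (high u * t ^ suc (block u)) + H * (high u * geometric t (block u)))
        ≈⟨ ∑-distrib-+ (λ u → T * (high u * t ^ suc (block u))) (λ u → H * (high u * geometric t (block u))) ⟩
      sum (λ u → T * (high u * t ^ suc (block u))) + sum (λ u → H * (high u * geometric t (block u)))
        ≈⟨ +-cong (*-distribˡ-sum T (λ u → high u * t ^ suc (block u))) (*-distribˡ-sum H (λ u → high u * geometric t (block u))) ⟨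
      T * Pₕ t + H * Gₕ t
        ≈⟨ solve 2 (λ p g → (con (+ 1) :+ :- g) :* p :+ p :* g := p) refl (Pₕ t) (Gₕ t) ⟩
      H ∎

    t*Ax≈x : ∀ u → t * sum (λ v → A u v * x v) ≈ x u
    t*Ax≈x u with toℕ u ℕ.<? s
    ... | yes u<s = begin
      t * sum (λ v → A u v * x v)   ≈⟨ *-congˡ (sum-cong-≋ λ v → trans (*-congʳ {x v} (reflexive (A-arc {u} {v} (arc-low u<s)))) (*-identityˡ (x v))) ⟩
      t * sum x                     ≈⟨ *-congˡ total ⟩
      t * T                         ≈⟨ solve 3 (λ t a b → t :* a := a :* (t :* con (+ 1)) :+ b :* con (+ 0)) refl t T H ⟩
      T * t ^ 1 + H * geometric t 0 ≡⟨ ≡.cong (λ q → T * t ^ suc q + H * geometric t q) (block-low u<s) ⟨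
      x u                           ∎
    ... | no u≮s = begin
      t * sum (λ v → A u v * x v)
        ≈⟨ *-congˡ (sum-cong-≋ λ v → trans (*-congʳ {x v} (row-high s≤u v)) (distribʳ (x v) (high v) (basis w v))) ⟩
      t * sum (λ v → high v * x v + basis w v * x v)
        ≈⟨ *-congˡ (∑-distrib-+ (λ v → high v * x v) (λ v → basis w v * x v)) ⟩
      t * (sum (λ v → high v * x v) + sum (λ v → basis w v * x v))
        ≈⟨ *-congˡ (+-cong total-high (trans (sum-cong-≋ λ v → *-comm (basis w v) (x v)) (∙-basis x w))) ⟩
      t * (H + x w)
        ≈⟨ solve 5 (λ t a p b g → t :* (b :+ (a :* p :+ b :* g)) := a :* (t :* p) :+ b :* (t :* (g :+ con (+ 1)))) refl t T (t ^ suc (block w)) H (geometric t (block w)) ⟩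
      T * t ^ suc (suc (block w)) + H * geometric t (suc (block w))
        ≡⟨ ≡.cong (λ q → T * t ^ suc q + H * geometric t q) (block-back s≤u) ⟨
      x u ∎
      where
      s≤u = ℕ.≮⇒≥ u≮s
      w = back s≤u

    eigen : (λ u → sum λ v → A u v * x v) ≋ (λ u → t ⁻¹ * x u)
    eigen u = begin
      sum (λ v → A u v * x v)               ≈⟨ *-identityˡ _ ⟨
      1# * sum (λ v → A u v * x v)          ≈⟨ *-congʳ (trans (*-comm _ _) (*-⁻¹ 0<t)) ⟨
      t ⁻¹ * t * sum (λ v → A u v * x v)    ≈⟨ *-assoc _ _ _ ⟩
      t ⁻¹ * (t * sum (λ v → A u v * x v))  ≈⟨ *-congˡ (t*Ax≈x u) ⟩
      t ⁻¹ * x u                            ∎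

  abstract
    perron-eigenvector : ∃[ ν ] (0# < ν × (∃ λ (x : Point k) → (∀ u → 0# < x u) × (λ u → sum λ v → A u v * x v) ≋ (λ u → ν * x u)))
    perron-eigenvector =
      let t , 0<t , nonneg , not-positive = first-zero positive-at-0 (1# , nonnegative⇒≤1)
          open Eigenvector 0<t nonneg not-positive
      in t ⁻¹ , 0<⁻¹ 0<t , x , 0<x , eigen

-- Growth rates through logarithms.

module Growth (R : RealNumbers) where
  open Exponential R

  module _ (ln : Carrier → Carrier) (isLn : IsNaturalLog ln) where

    -- Both sides are compared through their exponentials, so no functional equation of `ln` is
    -- required.
    ln-≤ : ∀ {w B x} → 0# < w → 0# < B → 0# < x → ∀ n → w ≤ B * x ^ n → ln w ≤ ln B + fromℕ n * ln x
    ln-≤ {w} {B} {x} 0<w 0<B 0<x n w≤ = exp-cancel-≤ (isLn w 0<w)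
      (IsExp-+ (isLn B 0<B) (IsExp-· (isLn x 0<x) n)) 0<w w≤

    ln-≥ : ∀ {w B x} → 0# < w → 0# < B → 0# < x → ∀ n → x ^ n ≤ B * w → fromℕ n * ln x ≤ ln B + ln w
    ln-≥ {w} {B} {x} 0<w 0<B 0<x n ≤w = exp-cancel-≤ (IsExp-· (isLn x 0<x) n)
      (IsExp-+ (isLn B 0<B) (isLn w 0<w)) (0<^ 0<x n) ≤w

    -- The two bounds confine `ln (w n) - n ln x` to a band whose width does not depend on `n`, and
    -- dividing by `n` makes it vanish in the limit.
    growth-rate : ∀ (w : ℕ → Carrier) {x B D} → 0# < x → 0# < B → 0# < D →
      (∀ n → 1 ℕ.≤ n → 0# < w n) → (∀ n → 1 ℕ.≤ n → w n ≤ B * x ^ n) → (∀ n → 1 ℕ.≤ n → x ^ n ≤ D * w n) →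
      (λ n → fromℕ n ⁻¹ * ln (w n)) ⟶ ln x
    growth-rate w {x} {B} {D} 0<x 0<B 0<D 0<w upper lower = ⟶-intro λ ε 0<ε →
      let N , Eε⁻¹<N = archimedean (E * ε ⁻¹)
      -- Starting at `suc N` ensures `n ≥ 1`, where the bounds on `w n` hold and `fromℕ n` is
      -- invertible.
      in suc N , λ n N<n →
        let 1≤n = ℕ.≤-trans (ℕ.s≤s ℕ.z≤n) N<n
            0<n = 0<fromℕ 1≤n
            E≤nε = ≤-respˡ (trans (*-assoc _ _ _) (trans (*-congˡ (trans (*-comm _ _) (*-⁻¹ 0<ε))) (*-identityʳ E)))
              (*-monoʳ-≤ (<⇒≤ 0<ε) (≤-trans (<⇒≤ Eε⁻¹<N) (fromℕ-mono-≤ (ℕ.<⇒≤ N<n))))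
        in ∣∣≤-trans (∣∣≤-cong (rearrange n 0<n) refl (∣∣≤-* (∣∣≤-refl (<⇒≤ (0<⁻¹ 0<n))) (deviation n 1≤n)))
          (≤-respʳ (cancel n 0<n ε) (*-monoˡ-≤ (<⇒≤ (0<⁻¹ 0<n)) E≤nε))
      where
      c = proj₁ (bound (ln B))
      d = proj₁ (bound (ln D))
      ∣lnB∣≤c = proj₂ (bound (ln B))
      ∣lnD∣≤d = proj₂ (bound (ln D))
      E = c + d
      deviation : ∀ n → 1 ℕ.≤ n → ∣ ln (w n) - fromℕ n * ln x ∣≤ E
      deviation n 1≤n =
        ≤-intro (0≤+ (∣∣≤⇒0≤ ∣lnB∣≤c) (0≤+ (≤-difference (proj₂ ∣lnD∣≤d)) (≤-difference (ln-≥ (0<w n 1≤n) 0<D 0<x n (lower n 1≤n)))))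
          (solve 5 (λ c d lD lw nx → :- (c :+ d) :+ (c :+ ((d :- lD) :+ (lD :+ lw :- nx))) := lw :- nx) refl c d (ln D) (ln (w n)) (fromℕ n * ln x)) ,
        ≤-intro (0≤+ (∣∣≤⇒0≤ ∣lnD∣≤d) (0≤+ (≤-difference (proj₂ ∣lnB∣≤c)) (≤-difference (ln-≤ (0<w n 1≤n) 0<B 0<x n (upper n 1≤n)))))
          (solve 5 (λ c d lB lw nx → lw :- nx :+ (d :+ ((c :- lB) :+ (lB :+ nx :- lw))) := c :+ d) refl c d (ln B) (ln (w n)) (fromℕ n * ln x))
      cancel : ∀ n → 0# < fromℕ n → ∀ y → fromℕ n ⁻¹ * (fromℕ n * y) ≈ y
      cancel n 0<n y = trans (solve 3 (λ i n y → i :* (n :* y) := (n :* i) :* y) refl (fromℕ n ⁻¹) (fromℕ n) y)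
        (trans (*-congʳ (*-⁻¹ 0<n)) (*-identityˡ y))
      rearrange : ∀ n → 0# < fromℕ n → fromℕ n ⁻¹ * (ln (w n) - fromℕ n * ln x) ≈ fromℕ n ⁻¹ * ln (w n) - ln x
      rearrange n 0<n = trans (solve 3 (λ i a b → i :* (a :- b) := i :* a :- i :* b) refl (fromℕ n ⁻¹) (ln (w n)) (fromℕ n * ln x))
        (+-congˡ (-‿cong (cancel n 0<n (ln x))))

-- The growth rate of the vertex numbers.

corollary4p17 : (R : RealNumbers) → let open Over R in
    (ln : Carrier → Carrier) → IsNaturalLog ln →
    (k s : ℕ) → 0 ℕ.< s → s ℕ.< k →
    (b : ℕ → ℕ) →
    (∀ n → 1 ℕ.≤ n → HasVertexCount (polytope n k s) (b n)) →
    (λ₁ : Carrier) →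
    IsLargestPositiveEigenvalue (adjacencyMatrix k s) λ₁ →
    (λ n → fromℕ n ⁻¹ * ln (fromℕ (b n))) ⟶ ln λ₁
corollary4p17 R ln isLn k s 0<s s<k b count λ₁ (0<λ₁ , isEigenvalue , largest) =
  growth-rate ln isLn (λ n → fromℕ (b n)) 0<λ₁ 0<B 0<D 0<b upper lower
  where
  open OrderedField R
  open Growth R
  open Exponential R using (∣∣≤-^)
  open VertexCount R 0<s s<k using (origin; vertexCount)
  open Spectrum R 0<s s<k using (walks-lower-bound; walks-upper-bound)
  open Perron R 0<s s<k using (perron-eigenvector)
  open Digraph {k} {s} s<k using (walks)
  open import Relation.Binary.Reasoning.Setoid setoid

  b≡walks : ∀ n → 1 ℕ.≤ n → b n ≡ walks n origin
  b≡walks (suc m) 1≤n = vertexCount m (count (suc m) 1≤n)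

  ν = proj₁ perron-eigenvector
  0<ν = proj₁ (proj₂ perron-eigenvector)
  x = proj₁ (proj₂ (proj₂ perron-eigenvector))
  0<x = proj₁ (proj₂ (proj₂ (proj₂ perron-eigenvector)))
  eigen = proj₂ (proj₂ (proj₂ (proj₂ perron-eigenvector)))

  ν≤λ₁ : ν ≤ λ₁
  ν≤λ₁ = largest ν 0<ν (x , (λ x≋0 → irrefl (sym (x≋0 origin)) (0<x origin)) , eigen)

  B = proj₁ (walks-upper-bound eigen 0<x)
  0<B = proj₁ (proj₂ (walks-upper-bound eigen 0<x))

  upper : ∀ n → 1 ℕ.≤ n → fromℕ (b n) ≤ B * λ₁ ^ n
  upper n 1≤n rewrite b≡walks n 1≤n = ≤-trans (proj₂ (proj₂ (walks-upper-bound eigen 0<x)) n)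
    (*-monoˡ-≤ (<⇒≤ 0<B) (^-monoˡ-≤ n))
    where
    ^-monoˡ-≤ : ∀ n → ν ^ n ≤ λ₁ ^ n
    ^-monoˡ-≤ n = proj₂ (∣∣≤-^ (∣∣≤-trans (∣∣≤-refl (<⇒≤ 0<ν)) ν≤λ₁) n)

  c = proj₁ (walks-lower-bound isEigenvalue)
  M = proj₁ (proj₂ (walks-lower-bound isEigenvalue))
  0<c = proj₁ (proj₂ (proj₂ (walks-lower-bound isEigenvalue)))
  0≤M = proj₁ (proj₂ (proj₂ (proj₂ (walks-lower-bound isEigenvalue))))
  c*λ₁^≤ = proj₂ (proj₂ (proj₂ (proj₂ (walks-lower-bound isEigenvalue))))

  0<M*walks : ∀ n → 0# < M * fromℕ (walks n origin)
  0<M*walks n = <-≤-trans (0<* 0<c (0<^ 0<λ₁ n)) (c*λ₁^≤ n)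

  0<M : 0# < M
  0<M with 0≤M
  ... | inj₁ p = p
  -- At `n = 0` the lower bound amounts to `c ≤ M`, with `c` positive.
  ... | inj₂ 0≈M = ⊥-elim (irrefl (sym (trans (*-congʳ (sym 0≈M)) (zeroˡ _))) (0<M*walks 0))

  D = c ⁻¹ * M
  0<D = 0<* (0<⁻¹ 0<c) 0<M

  0<b : ∀ n → 1 ℕ.≤ n → 0# < fromℕ (b n)
  0<b n 1≤n rewrite b≡walks n 1≤n with 0≤fromℕ (walks n origin)
  ... | inj₁ p = p
  ... | inj₂ 0≈w = ⊥-elim (irrefl (sym (trans (*-congˡ (sym 0≈w)) (zeroʳ _))) (0<M*walks n))

  lower : ∀ n → 1 ℕ.≤ n → λ₁ ^ n ≤ D * fromℕ (b n)
  lower n 1≤n rewrite b≡walks n 1≤n = *-cancelˡ-≤ 0<c (≤-respʳ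
    (begin
      M * w                 ≈⟨ *-identityˡ _ ⟨
      1# * (M * w)          ≈⟨ *-congʳ (*-⁻¹ 0<c) ⟨
      c * c ⁻¹ * (M * w)    ≈⟨ solve 4 (λ c i m w → c :* i :* (m :* w) := c :* (i :* m :* w)) refl c (c ⁻¹) M w ⟩
      c * (D * w)           ∎)
    (c*λ₁^≤ n))
    where w = fromℕ (walks n origin)
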